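{- Suppose $\alpha\ge1$ and $\alpha>e^{\alpha-2}$ (equivalently, $1\le\alpha<\alpha_\infty$, where $\alpha_\infty\approx3.146$ is the root in $[3,4]$ of $a=e^{a-2}$). Then there exists a positive integer $k$ such that no deterministic strictly monotone online algorithm for maximizing a non-negative monotone submodular function under a $k$-uniform matroid constraint with free disposal has competitive ratio $\frac1\alpha$.
   Context: Online problem with free disposal ($k$-uniform matroid): $\Omega$ is a ground set and $f:2^\Omega\to\mathbb{R}_+$ is submodular and monotone ($S\subseteq T$ implies $f(S)\le f(T)$). Distinct elements of $\Omega$ arrive one by one in a finite sequence whose length is unknown to the algorithm. The algorithm maintains a set $S$, initially empty, with $|S|\le k$. In each round, when $u$ arrives, it may remove elements from $S$ and may include $u$ in $S$, provided $|S|\le k$ afterwards; rejected or removed elements cannot be retrieved. The algorithm knows $k$ and has value oracle access to $f$ only on sets of elements that have arrived so far, so the decisions of a deterministic algorithm are determined by this information. $\mathsf{OPT}$ is a subset of at most $k$ elements of the sequence maximizing $f$. A deterministic algorithm has competitive ratio $r$ if for every instance and at the end of every finite sequence, $f(S)\ge r\cdot f(\mathsf{OPT})$. Strict monotonicity: an algorithm is strictly monotone if, in each round, it includes the new arriving element into $S$ (possibly removing some elements from $S$) only if the objective value $f(S)$ strictly increases compared to its value at the beginning of the round. -}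

module Defs where

open import Data.Fin.Base using (Fin; toℕ)
open import Data.Fin.Subset using (Subset; Side; inside; outside; ⊥; ⁅_⁆; _∪_; _∩_; _⊆_; ∣_∣)
open import Data.Integer.Base as ℤ using (+_; -[1+_])
import Data.Integer.Properties as ℤ
open import Data.Nat.Base as ℕ using (ℕ; zero; suc; _⊔_)
import Data.Nat.Properties as ℕ
open import Data.Product.Base using (∃; _×_; _,_; proj₁; proj₂)
open import Data.Rational.Base as ℚ using (ℚ; 0ℚ; 1ℚ; mkℚ; _/_; toℚᵘ)
import Data.Rational.Properties as ℚ
open import Data.Rational.Solver using (module +-*-Solver)
import Data.Rational.Unnormalised.Base as ℚᵘ
import Data.Rational.Unnormalised.Properties as ℚᵘ
open import Data.Vec.Base using (Vec; []; _∷_; map; head)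
open import Data.Vec.Relation.Unary.Unique.Propositional using (Unique)
open import Relation.Binary.PropositionalEquality
  using (_≡_; refl; sym; trans; cong; cong₂; subst; subst₂)
open import Relation.Nullary.Decidable using (yes; no)
open import Relation.Nullary.Negation using (contradiction)

------------------------------------------------------------------------
-- Rational arithmetic

open +-*-Solver using (solve; _:+_; _:-_; _:*_; _:=_)

telescope : ∀ p q r → (p ℚ.- q) ℚ.+ (q ℚ.- r) ≡ p ℚ.- r
telescope = solve 3 (λ p q r → (p :- q) :+ (q :- r) := p :- r) refl

cancel : ∀ p q → (p ℚ.- q) ℚ.+ q ≡ p
cancel = solve 2 (λ p q → (p :- q) :+ q := p) refl

sum-diff : ∀ a b c d → (a ℚ.- c) ℚ.+ (b ℚ.- d) ≡ (a ℚ.+ b) ℚ.- (c ℚ.+ d)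
sum-diff = solve 4 (λ a b c d → (a :- c) :+ (b :- d) := (a :+ b) :- (c :+ d)) refl

product-diff : ∀ a b c d → a ℚ.* (b ℚ.- d) ℚ.+ d ℚ.* (a ℚ.- c) ≡ a ℚ.* b ℚ.- c ℚ.* d
product-diff = solve 4 (λ a b c d → a :* (b :- d) :+ d :* (a :- c) := a :* b :- c :* d) refl

recip-diff : ∀ p q a b → p ℚ.* (q ℚ.* b) ℚ.- q ℚ.* (p ℚ.* a) ≡ (p ℚ.* q) ℚ.* (b ℚ.- a)
recip-diff = solve 4 (λ p q a b → p :* (q :* b) :- q :* (p :* a) := (p :* q) :* (b :- a)) refl

twice : ∀ p → p ℚ.+ p ≡ (1ℚ ℚ.+ 1ℚ) ℚ.* p
twice p = trans (cong₂ ℚ._+_ (sym (ℚ.*-identityˡ p)) (sym (ℚ.*-identityˡ p)))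
  (sym (ℚ.*-distribʳ-+ p 1ℚ 1ℚ))

thrice : ∀ p → p ℚ.+ (p ℚ.+ p) ≡ (1ℚ ℚ.+ (1ℚ ℚ.+ 1ℚ)) ℚ.* p
thrice p = trans (cong₂ ℚ._+_ (sym (ℚ.*-identityˡ p)) (twice p))
  (sym (ℚ.*-distribʳ-+ p 1ℚ (1ℚ ℚ.+ 1ℚ)))

half-term : ∀ t b r → (t ℚ.* b) ℚ.* r ℚ.+ (t ℚ.* b) ℚ.* r ≡ t ℚ.* ((b ℚ.+ b) ℚ.* r)
half-term = solve 3 (λ t b r → (t :* b) :* r :+ (t :* b) :* r := t :* ((b :+ b) :* r)) refl

double-product : ∀ s u → (s ℚ.+ s) ℚ.* u ≡ s ℚ.* (u ℚ.+ u)
double-product = solve 2 (λ s u → (s :+ s) :* u := s :* (u :+ u)) refl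

swap-last : ∀ a b c → (a ℚ.+ b) ℚ.+ c ≡ (a ℚ.+ c) ℚ.+ b
swap-last = solve 3 (λ a b c → (a :+ b) :+ c := (a :+ c) :+ b) refl

*-monoʳ : ∀ {c p q} → 0ℚ ℚ.≤ c → p ℚ.≤ q → c ℚ.* p ℚ.≤ c ℚ.* q
*-monoʳ {c} 0≤c = ℚ.*-monoˡ-≤-nonNeg c {{ℚ.nonNegative 0≤c}}

*-monoˡ : ∀ {c p q} → 0ℚ ℚ.≤ c → p ℚ.≤ q → p ℚ.* c ℚ.≤ q ℚ.* c
*-monoˡ {c} 0≤c = ℚ.*-monoʳ-≤-nonNeg c {{ℚ.nonNegative 0≤c}}

0≤* : ∀ {p q} → 0ℚ ℚ.≤ p → 0ℚ ℚ.≤ q → 0ℚ ℚ.≤ p ℚ.* q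
0≤* {p} {q} 0≤p 0≤q = subst (ℚ._≤ p ℚ.* q) (ℚ.*-zeroʳ p) (*-monoʳ 0≤p 0≤q)

0<* : ∀ {p q} → 0ℚ ℚ.< p → 0ℚ ℚ.< q → 0ℚ ℚ.< p ℚ.* q
0<* {p} {q} 0<p 0<q =
  subst (ℚ._< p ℚ.* q) (ℚ.*-zeroʳ p) (ℚ.*-monoʳ-<-pos p {{ℚ.positive 0<p}} 0<q)

0<+ : ∀ {p q} → 0ℚ ℚ.< p → 0ℚ ℚ.< q → 0ℚ ℚ.< p ℚ.+ q
0<+ 0<p 0<q = ℚ.+-mono-< 0<p 0<q

0<1 : 0ℚ ℚ.< 1ℚ
0<1 = ℚ.positive⁻¹ 1ℚ

∣-∣-comm : ∀ p q → ℚ.∣ p ℚ.- q ∣ ≡ ℚ.∣ q ℚ.- p ∣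
∣-∣-comm p q = trans (sym (ℚ.∣-p∣≡∣p∣ (p ℚ.- q)))
  (cong ℚ.∣_∣ (trans (ℚ.neg-distrib-+ p (ℚ.- q))
    (trans (cong (ℚ.- p ℚ.+_) (neg-neg q)) (ℚ.+-comm (ℚ.- p) q))))
  where
  neg-neg : ∀ r → ℚ.- (ℚ.- r) ≡ r
  neg-neg (mkℚ (+ 0) _ _) = refl
  neg-neg (mkℚ (+ suc _) _ _) = refl
  neg-neg (mkℚ -[1+ _ ] _ _) = refl

triangle : ∀ p q r → ℚ.∣ p ℚ.- r ∣ ℚ.≤ ℚ.∣ p ℚ.- q ∣ ℚ.+ ℚ.∣ q ℚ.- r ∣
triangle p q r = subst (λ z → ℚ.∣ z ∣ ℚ.≤ ℚ.∣ p ℚ.- q ∣ ℚ.+ ℚ.∣ q ℚ.- r ∣)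
  (telescope p q r)
  (ℚ.∣p+q∣≤∣p∣+∣q∣ (p ℚ.- q) (q ℚ.- r))

∣+∣≤ : ∀ p q {P Q} → ℚ.∣ p ∣ ℚ.≤ P → ℚ.∣ q ∣ ℚ.≤ Q → ℚ.∣ p ℚ.+ q ∣ ℚ.≤ P ℚ.+ Q
∣+∣≤ p q {P} {Q} p≤P q≤Q = ℚ.≤-trans (ℚ.∣p+q∣≤∣p∣+∣q∣ p q)
  (ℚ.+-mono-≤ {ℚ.∣ p ∣} {P} {ℚ.∣ q ∣} {Q} p≤P q≤Q)

∣*∣≤ : ∀ p q {P Q} → ℚ.∣ p ∣ ℚ.≤ P → ℚ.∣ q ∣ ℚ.≤ Q → ℚ.∣ p ℚ.* q ∣ ℚ.≤ P ℚ.* Q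
∣*∣≤ p q {P} {Q} p≤P q≤Q = subst (ℚ._≤ P ℚ.* Q) (sym (ℚ.∣p*q∣≡∣p∣*∣q∣ p q))
  (ℚ.≤-trans (*-monoˡ {ℚ.∣ q ∣} {ℚ.∣ p ∣} {P} (ℚ.0≤∣p∣ q) p≤P)
             (*-monoʳ {P} {ℚ.∣ q ∣} {Q} (ℚ.≤-trans (ℚ.0≤∣p∣ p) p≤P) q≤Q))

+-/1 : ∀ n → + suc n / 1 ≡ + n / 1 ℚ.+ 1ℚ
+-/1 n = ℚ.toℚᵘ-injective (ℚᵘ.≃-trans (ℚ.toℚᵘ-fromℚᵘ (ℚᵘ.mkℚᵘ (+ suc n) 0))
  (ℚᵘ.≃-trans (ℚᵘ.*≡* eq)
  (ℚᵘ.≃-sym (ℚᵘ.≃-trans (ℚ.toℚᵘ-homo-+ (+ n / 1) 1ℚ)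
    (ℚᵘ.+-congˡ ℚᵘ.1ℚᵘ (ℚ.toℚᵘ-fromℚᵘ (ℚᵘ.mkℚᵘ (+ n) 0)))))))
  where
  eq : + suc n ℤ.* + 1 ≡ (+ n ℤ.* + 1 ℤ.+ + 1 ℤ.* + 1) ℤ.* + 1
  eq = cong (ℤ._* + 1) (trans (cong +_ (ℕ.+-comm 1 n))
         (cong (ℤ._+ + 1) (sym (ℤ.*-identityʳ (+ n)))))

*-/suc : ∀ i → (+ suc i / 1) ℚ.* (+ 1 / suc i) ≡ 1ℚ
*-/suc i = ℚ.toℚᵘ-injective (ℚᵘ.≃-trans (ℚ.toℚᵘ-homo-* (+ suc i / 1) (+ 1 / suc i))
  (ℚᵘ.≃-trans (ℚᵘ.*-cong (ℚ.toℚᵘ-fromℚᵘ (ℚᵘ.mkℚᵘ (+ suc i) 0))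
                         (ℚ.toℚᵘ-fromℚᵘ (ℚᵘ.mkℚᵘ (+ 1) i)))
  (ℚᵘ.*≡* (trans (ℤ.*-identityʳ (+ suc i ℤ.* + 1))
     (trans (ℤ.*-identityʳ (+ suc i)) (trans (cong (λ z → + suc z) (sym (ℕ.+-identityʳ i)))
       (sym (ℤ.*-identityˡ (+ suc (i ℕ.+ 0))))))))))

/1-mono : ∀ {m n} → m ℕ.≤ n → + m / 1 ℚ.≤ + n / 1
/1-mono {m} {n} m≤n = ℚ.toℚᵘ-cancel-≤
  (ℚᵘ.≤-respʳ-≃ (ℚᵘ.≃-sym (ℚ.toℚᵘ-fromℚᵘ (ℚᵘ.mkℚᵘ (+ n) 0)))
  (ℚᵘ.≤-respˡ-≃ (ℚᵘ.≃-sym (ℚ.toℚᵘ-fromℚᵘ (ℚᵘ.mkℚᵘ (+ m) 0)))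
  (ℚᵘ.*≤* (ℤ.*-monoʳ-≤-nonNeg (+ 1) (ℤ.+≤+ m≤n)))))

0≤/suc : ∀ m i → 0ℚ ℚ.≤ + m / suc i
0≤/suc m i = ℚ.nonNegative⁻¹ (+ m / suc i) {{ℚ.normalize-nonNeg m (suc i)}}

archimedean : ∀ p → ∃ λ n → p ℚ.≤ + n / 1
archimedean p@(mkℚ -[1+ _ ] _ _) = 0 , ℚ.<⇒≤ (ℚ.negative⁻¹ p)
archimedean p@(mkℚ (+ n) d _) = n , ℚ.toℚᵘ-cancel-≤
  (ℚᵘ.≤-respʳ-≃ (ℚᵘ.≃-sym (ℚ.toℚᵘ-fromℚᵘ (ℚᵘ.mkℚᵘ (+ n) 0)))
  (ℚᵘ.*≤* (ℤ.*-monoˡ-≤-nonNeg (+ n) (ℤ.+≤+ (ℕ.s≤s ℕ.z≤n)))))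

scale-ε : ∀ C ε → 0ℚ ℚ.< C → 0ℚ ℚ.< ε → ∃ λ δ → 0ℚ ℚ.< δ × C ℚ.* δ ≡ ε
scale-ε C ε 0<C 0<ε = C⁻¹ ℚ.* ε , 0<* (ℚ.positive⁻¹ C⁻¹ {{ℚ.1/pos⇒pos C}}) 0<ε
  , trans (sym (ℚ.*-assoc C C⁻¹ ε)) (trans (cong (ℚ._* ε) (ℚ.*-inverseʳ C)) (ℚ.*-identityˡ ε))
  where
  instance
    C-pos = ℚ.positive 0<C
    C-nonZero = ℚ.pos⇒nonZero C
  C⁻¹ = ℚ.1/ C

------------------------------------------------------------------------
-- Real numbers: Cauchy sequences of rationals.  Equality of reals is not
-- needed: everything below is stated through _≤_ and _<_, which do not
-- depend on the representing sequences.

Cauchy : (ℕ → ℚ) → Set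
Cauchy x = ∀ ε → 0ℚ ℚ.< ε →
  ∃ λ N → ∀ m n → N ℕ.≤ m → N ℕ.≤ n → ℚ.∣ x m ℚ.- x n ∣ ℚ.≤ ε

record ℝ : Set where
  constructor mkℝ
  field
    seq    : ℕ → ℚ
    cauchy : Cauchy seq

open ℝ public

infix 4 _≤_ _<_

_≤_ : ℝ → ℝ → Set
x ≤ y = ∀ ε → 0ℚ ℚ.< ε → ∃ λ N → ∀ n → N ℕ.≤ n → seq x n ℚ.≤ seq y n ℚ.+ ε

_<_ : ℝ → ℝ → Set
x < y = ∃ λ ε → 0ℚ ℚ.< ε × ∃ λ N → ∀ n → N ℕ.≤ n → seq x n ℚ.+ ε ℚ.≤ seq y n

cauchy-scale : ∀ x C → 0ℚ ℚ.< C →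
  (∀ ε → 0ℚ ℚ.< ε → ∃ λ N → ∀ m n → N ℕ.≤ m → N ℕ.≤ n → ℚ.∣ x m ℚ.- x n ∣ ℚ.≤ C ℚ.* ε) →
  Cauchy x
cauchy-scale x C 0<C h ε 0<ε with scale-ε C ε 0<C 0<ε
... | δ , 0<δ , Cδ≡ε with h δ 0<δ
...   | N , p = N , λ m n N≤m N≤n → subst (ℚ.∣ x m ℚ.- x n ∣ ℚ.≤_) Cδ≡ε (p m n N≤m N≤n)

bounded : ∀ x → Cauchy x →
  ∃ λ B → 0ℚ ℚ.< B × ∃ λ N → ∀ n → N ℕ.≤ n → ℚ.∣ x n ∣ ℚ.≤ B
bounded x c with c 1ℚ 0<1
... | N , p = 1ℚ ℚ.+ ℚ.∣ x N ∣ , ℚ.+-mono-<-≤ 0<1 (ℚ.0≤∣p∣ (x N)) , N , λ n N≤n →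
  ℚ.≤-trans (subst (λ z → ℚ.∣ z ∣ ℚ.≤ ℚ.∣ x n ℚ.- x N ∣ ℚ.+ ℚ.∣ x N ∣)
    (cancel (x n) (x N))
    (ℚ.∣p+q∣≤∣p∣+∣q∣ (x n ℚ.- x N) (x N)))
  (ℚ.+-monoˡ-≤ ℚ.∣ x N ∣ (p n N N≤n ℕ.≤-refl))

const-cauchy : ∀ q → Cauchy (λ _ → q)
const-cauchy q ε 0<ε = 0 , λ _ _ _ _ →
  subst (λ z → ℚ.∣ z ∣ ℚ.≤ ε) (sym (ℚ.+-inverseʳ q)) (ℚ.<⇒≤ 0<ε)

+-cauchy : ∀ x y → Cauchy x → Cauchy y → Cauchy (λ n → x n ℚ.+ y n)
+-cauchy x y cx cy = cauchy-scale (λ n → x n ℚ.+ y n) (1ℚ ℚ.+ 1ℚ) (0<+ 0<1 0<1) step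
  where
  step : ∀ ε → 0ℚ ℚ.< ε → ∃ λ N → ∀ m n → N ℕ.≤ m → N ℕ.≤ n →
    ℚ.∣ (x m ℚ.+ y m) ℚ.- (x n ℚ.+ y n) ∣ ℚ.≤ (1ℚ ℚ.+ 1ℚ) ℚ.* ε
  step ε 0<ε = let N₁ , p₁ = cx ε 0<ε ; N₂ , p₂ = cy ε 0<ε in
    N₁ ⊔ N₂ , λ m n N≤m N≤n → begin
    ℚ.∣ (x m ℚ.+ y m) ℚ.- (x n ℚ.+ y n) ∣
      ≡⟨ cong ℚ.∣_∣ (sum-diff (x m) (y m) (x n) (y n)) ⟨
    ℚ.∣ (x m ℚ.- x n) ℚ.+ (y m ℚ.- y n) ∣
      ≤⟨ ∣+∣≤ (x m ℚ.- x n) (y m ℚ.- y n)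
           (p₁ m n (ℕ.m⊔n≤o⇒m≤o N₁ N₂ N≤m) (ℕ.m⊔n≤o⇒m≤o N₁ N₂ N≤n))
           (p₂ m n (ℕ.m⊔n≤o⇒n≤o N₁ N₂ N≤m) (ℕ.m⊔n≤o⇒n≤o N₁ N₂ N≤n)) ⟩
    ε ℚ.+ ε
      ≡⟨ twice ε ⟩
    (1ℚ ℚ.+ 1ℚ) ℚ.* ε ∎
    where open ℚ.≤-Reasoning

*-cauchy : ∀ x y → Cauchy x → Cauchy y → Cauchy (λ n → x n ℚ.* y n)
*-cauchy x y cx cy =
  cauchy-scale (λ n → x n ℚ.* y n) (B ℚ.+ C) (0<+ (proj₁ (proj₂ bx)) (proj₁ (proj₂ by))) step
  where
  bx = bounded x cx
  by = bounded y cy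
  B = proj₁ bx
  C = proj₁ by
  M₁ = proj₁ (proj₂ (proj₂ bx))
  M₂ = proj₁ (proj₂ (proj₂ by))
  b : ∀ n → M₁ ℕ.≤ n → ℚ.∣ x n ∣ ℚ.≤ B
  b = proj₂ (proj₂ (proj₂ bx))
  c : ∀ n → M₂ ℕ.≤ n → ℚ.∣ y n ∣ ℚ.≤ C
  c = proj₂ (proj₂ (proj₂ by))

  step : ∀ ε → 0ℚ ℚ.< ε → ∃ λ N → ∀ m n → N ℕ.≤ m → N ℕ.≤ n →
    ℚ.∣ x m ℚ.* y m ℚ.- x n ℚ.* y n ∣ ℚ.≤ (B ℚ.+ C) ℚ.* ε
  step ε 0<ε = let N₁ , p₁ = cx ε 0<ε ; N₂ , p₂ = cy ε 0<ε in
    (M₁ ⊔ M₂) ⊔ (N₁ ⊔ N₂) , λ m n N≤m N≤n →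
    let M₁₂≤m = ℕ.m⊔n≤o⇒m≤o (M₁ ⊔ M₂) (N₁ ⊔ N₂) N≤m
        M₁₂≤n = ℕ.m⊔n≤o⇒m≤o (M₁ ⊔ M₂) (N₁ ⊔ N₂) N≤n
        N₁₂≤m = ℕ.m⊔n≤o⇒n≤o (M₁ ⊔ M₂) (N₁ ⊔ N₂) N≤m
        N₁₂≤n = ℕ.m⊔n≤o⇒n≤o (M₁ ⊔ M₂) (N₁ ⊔ N₂) N≤n
    in begin
    ℚ.∣ x m ℚ.* y m ℚ.- x n ℚ.* y n ∣
      ≡⟨ cong ℚ.∣_∣ (product-diff (x m) (y m) (x n) (y n)) ⟨
    ℚ.∣ x m ℚ.* (y m ℚ.- y n) ℚ.+ y n ℚ.* (x m ℚ.- x n) ∣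
      ≤⟨ ∣+∣≤ (x m ℚ.* (y m ℚ.- y n)) (y n ℚ.* (x m ℚ.- x n))
           (∣*∣≤ (x m) (y m ℚ.- y n) (b m (ℕ.m⊔n≤o⇒m≤o M₁ M₂ M₁₂≤m))
             (p₂ m n (ℕ.m⊔n≤o⇒n≤o N₁ N₂ N₁₂≤m) (ℕ.m⊔n≤o⇒n≤o N₁ N₂ N₁₂≤n)))
           (∣*∣≤ (y n) (x m ℚ.- x n) (c n (ℕ.m⊔n≤o⇒n≤o M₁ M₂ M₁₂≤n))
             (p₁ m n (ℕ.m⊔n≤o⇒m≤o N₁ N₂ N₁₂≤m) (ℕ.m⊔n≤o⇒m≤o N₁ N₂ N₁₂≤n))) ⟩
    B ℚ.* ε ℚ.+ C ℚ.* ε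
      ≡⟨ ℚ.*-distribʳ-+ ε B C ⟨
    (B ℚ.+ C) ℚ.* ε ∎
    where open ℚ.≤-Reasoning

fromℚ : ℚ → ℝ
fromℚ q = mkℝ (λ _ → q) (const-cauchy q)

0ℝ 1ℝ 2ℝ : ℝ
0ℝ = fromℚ 0ℚ
1ℝ = fromℚ 1ℚ
2ℝ = fromℚ (+ 2 / 1)

infix  8 _⁻¹⟨_⟩
infixl 7 _*_
infixl 6 _+_ _-_

_+_ _*_ _-_ : ℝ → ℝ → ℝ
x + y = mkℝ (λ n → seq x n ℚ.+ seq y n) (+-cauchy (seq x) (seq y) (cauchy x) (cauchy y))
x * y = mkℝ (λ n → seq x n ℚ.* seq y n) (*-cauchy (seq x) (seq y) (cauchy x) (cauchy y))
x - y = x + fromℚ (ℚ.- 1ℚ) * y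

------------------------------------------------------------------------
-- Reciprocal of a positive real

-- The value at 0 is irrelevant: it can only occur at finitely many indices.
recip : ℚ → ℚ
recip q with q ℚ.≟ 0ℚ
... | yes _   = 0ℚ
... | no q≢0 = (ℚ.1/ q) {{ℚ.≢-nonZero q≢0}}

recip-inverse : ∀ q → 0ℚ ℚ.< q → recip q ℚ.* q ≡ 1ℚ
recip-inverse q 0<q with q ℚ.≟ 0ℚ
... | yes q≡0 = contradiction (subst (0ℚ ℚ.<_) q≡0 0<q) (ℚ.<-irrefl refl)
... | no q≢0 = ℚ.*-inverseˡ q {{ℚ.≢-nonZero q≢0}}

0≤recip : ∀ q → 0ℚ ℚ.< q → 0ℚ ℚ.≤ recip q
0≤recip q 0<q = ℚ.*-cancelʳ-≤-pos q {{ℚ.positive 0<q}}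
  (subst₂ ℚ._≤_ (sym (ℚ.*-zeroˡ q)) (sym (recip-inverse q 0<q)) (ℚ.<⇒≤ 0<1))

recip-anti : ∀ {p q} → 0ℚ ℚ.< p → p ℚ.≤ q → recip q ℚ.≤ recip p
recip-anti {p} {q} 0<p p≤q = ℚ.*-cancelʳ-≤-pos p {{ℚ.positive 0<p}}
  (subst (recip q ℚ.* p ℚ.≤_) (trans (recip-inverse q 0<q) (sym (recip-inverse p 0<p)))
    (*-monoʳ (0≤recip q 0<q) p≤q))
  where 0<q = ℚ.<-≤-trans 0<p p≤q

recip-cauchy : ∀ x → Cauchy x → ∀ δ → 0ℚ ℚ.< δ →
  (∃ λ N → ∀ n → N ℕ.≤ n → δ ℚ.≤ x n) → Cauchy (λ n → recip (x n))
recip-cauchy x c δ 0<δ (M , δ≤) = cauchy-scale (λ n → recip (x n)) (D ℚ.* D) (0<* 0<D 0<D) λ ε 0<ε →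
  let N , p = c ε 0<ε
  in M ⊔ N , λ m n N≤m N≤n → close (x m) (x n)
       (δ≤ m (ℕ.m⊔n≤o⇒m≤o M N N≤m)) (δ≤ n (ℕ.m⊔n≤o⇒m≤o M N N≤n))
       (p m n (ℕ.m⊔n≤o⇒n≤o M N N≤m) (ℕ.m⊔n≤o⇒n≤o M N N≤n))
  where
  D = recip δ

  0<D : 0ℚ ℚ.< D
  0<D = ℚ.*-cancelʳ-<-nonNeg δ {{ℚ.nonNegative (ℚ.<⇒≤ 0<δ)}}
    (subst₂ ℚ._<_ (sym (ℚ.*-zeroˡ δ)) (sym (recip-inverse δ 0<δ)) 0<1)

  close : ∀ a b {ε} → δ ℚ.≤ a → δ ℚ.≤ b → ℚ.∣ a ℚ.- b ∣ ℚ.≤ ε →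
    ℚ.∣ recip a ℚ.- recip b ∣ ℚ.≤ (D ℚ.* D) ℚ.* ε
  close a b {ε} δ≤a δ≤b ab≤ε = begin
    ℚ.∣ ra ℚ.- rb ∣
      ≡⟨ cong ℚ.∣_∣ (cong₂ ℚ._-_ (trans (sym (ℚ.*-identityʳ ra)) (cong (ra ℚ.*_) (sym rb*b)))
                                (trans (sym (ℚ.*-identityʳ rb)) (cong (rb ℚ.*_) (sym ra*a)))) ⟩
    ℚ.∣ ra ℚ.* (rb ℚ.* b) ℚ.- rb ℚ.* (ra ℚ.* a) ∣
      ≡⟨ cong ℚ.∣_∣ (recip-diff ra rb a b) ⟩
    ℚ.∣ (ra ℚ.* rb) ℚ.* (b ℚ.- a) ∣
      ≡⟨ ℚ.∣p*q∣≡∣p∣*∣q∣ (ra ℚ.* rb) (b ℚ.- a) ⟩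
    ℚ.∣ ra ℚ.* rb ∣ ℚ.* ℚ.∣ b ℚ.- a ∣
      ≡⟨ cong₂ ℚ._*_ (ℚ.0≤p⇒∣p∣≡p (0≤* 0≤ra 0≤rb)) (∣-∣-comm b a) ⟩
    (ra ℚ.* rb) ℚ.* ℚ.∣ a ℚ.- b ∣
      ≤⟨ *-monoʳ (0≤* 0≤ra 0≤rb) ab≤ε ⟩
    (ra ℚ.* rb) ℚ.* ε
      ≤⟨ *-monoˡ (ℚ.≤-trans (ℚ.0≤∣p∣ (a ℚ.- b)) ab≤ε)
           (ℚ.≤-trans (*-monoˡ 0≤rb (recip-anti 0<δ δ≤a))
                      (*-monoʳ (ℚ.<⇒≤ 0<D) (recip-anti 0<δ δ≤b))) ⟩
    (D ℚ.* D) ℚ.* ε ∎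
    where
    open ℚ.≤-Reasoning
    ra = recip a
    rb = recip b
    0<a = ℚ.<-≤-trans 0<δ δ≤a
    0<b = ℚ.<-≤-trans 0<δ δ≤b
    ra*a = recip-inverse a 0<a
    rb*b = recip-inverse b 0<b
    0≤ra = 0≤recip a 0<a
    0≤rb = 0≤recip b 0<b

_⁻¹⟨_⟩ : (x : ℝ) → 0ℝ < x → ℝ
x ⁻¹⟨ ε , 0<ε , N , p ⟩ = mkℝ (λ n → recip (seq x n))
  (recip-cauchy (seq x) (cauchy x) ε 0<ε
    (N , λ n N≤n → subst (ℚ._≤ seq x n) (ℚ.+-identityˡ ε) (p n N≤n)))

1≤⇒0< : ∀ {x} → 1ℝ ≤ x → 0ℝ < x
1≤⇒0< {x} 1≤x = let N , p = 1≤x ℚ.½ 0<½ in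
  ℚ.½ , 0<½ , N , λ n N≤n →
  subst (ℚ.½ ℚ.≤_) (trans (ℚ.+-assoc (seq x n) ℚ.½ ℚ.-½) (ℚ.+-identityʳ (seq x n)))
    (ℚ.+-monoˡ-≤ ℚ.-½ (p n N≤n))
  where
  0<½ : 0ℚ ℚ.< ℚ.½
  0<½ = ℚ.positive⁻¹ ℚ.½

------------------------------------------------------------------------
-- The exponential function

-- expTerm q i = qⁱ / i!  and  expSum q n = Σ_{i ≤ n} qⁱ / i!
expTerm : ℚ → ℕ → ℚ
expTerm q zero    = 1ℚ
expTerm q (suc i) = (expTerm q i ℚ.* q) ℚ.* (+ 1 / suc i)

expSum : ℚ → ℕ → ℚ
expSum q zero    = expTerm q zero
expSum q (suc n) = expSum q n ℚ.+ expTerm q (suc n)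

expTerm-cauchy : ∀ x → Cauchy x → ∀ i → Cauchy (λ n → expTerm (x n) i)
expTerm-cauchy x c zero    = const-cauchy 1ℚ
expTerm-cauchy x c (suc i) =
  *-cauchy (λ n → expTerm (x n) i ℚ.* x n) (λ _ → + 1 / suc i)
    (*-cauchy (λ n → expTerm (x n) i) x (expTerm-cauchy x c i) c) (const-cauchy (+ 1 / suc i))

expSum-cauchy : ∀ x → Cauchy x → ∀ i → Cauchy (λ n → expSum (x n) i)
expSum-cauchy x c zero    = expTerm-cauchy x c zero
expSum-cauchy x c (suc i) =
  +-cauchy (λ n → expSum (x n) i) (λ n → expTerm (x n) (suc i))
    (expSum-cauchy x c i) (expTerm-cauchy x c (suc i))

module ExpTail (B : ℕ) where
  b : ℚ
  b = + B / 1

  t : ℕ → ℚ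
  t = expTerm b

  0≤b : 0ℚ ℚ.≤ b
  0≤b = 0≤/suc B 0

  0≤t : ∀ i → 0ℚ ℚ.≤ t i
  0≤t zero    = ℚ.<⇒≤ 0<1
  0≤t (suc i) = 0≤* (0≤* (0≤t i) 0≤b) (0≤/suc 1 i)

  expTerm≤t : ∀ q → ℚ.∣ q ∣ ℚ.≤ b → ∀ i → ℚ.∣ expTerm q i ∣ ℚ.≤ t i
  expTerm≤t q q≤b zero    = ℚ.≤-refl
  expTerm≤t q q≤b (suc i) = begin
    ℚ.∣ (e ℚ.* q) ℚ.* r ∣           ≡⟨ ℚ.∣p*q∣≡∣p∣*∣q∣ (e ℚ.* q) r ⟩
    ℚ.∣ e ℚ.* q ∣ ℚ.* ℚ.∣ r ∣       ≡⟨ cong₂ ℚ._*_ (ℚ.∣p*q∣≡∣p∣*∣q∣ e q) (ℚ.0≤p⇒∣p∣≡p (0≤/suc 1 i)) ⟩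
    (ℚ.∣ e ∣ ℚ.* ℚ.∣ q ∣) ℚ.* r     ≤⟨ *-monoˡ (0≤/suc 1 i) (ℚ.≤-trans
                                        (*-monoˡ (ℚ.0≤∣p∣ q) (expTerm≤t q q≤b i))
                                        (*-monoʳ (0≤t i) q≤b)) ⟩
    (t i ℚ.* b) ℚ.* r               ∎
    where
    open ℚ.≤-Reasoning
    e = expTerm q i
    r = + 1 / suc i

  2b≤ : ∀ i → B ℕ.+ B ℕ.≤ i → b ℚ.+ b ℚ.≤ + i / 1
  2b≤ i 2B≤i = subst (ℚ._≤ + i / 1) (double B) (/1-mono 2B≤i)
    where
    +-homo : ∀ m n → + (m ℕ.+ n) / 1 ≡ (+ m / 1) ℚ.+ (+ n / 1)
    +-homo zero    n = sym (ℚ.+-identityˡ (+ n / 1))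
    +-homo (suc m) n = trans (+-/1 (m ℕ.+ n)) (trans (cong (ℚ._+ 1ℚ) (+-homo m n))
      (trans (swap-last (+ m / 1) (+ n / 1) 1ℚ)
        (cong (ℚ._+ (+ n / 1)) (sym (+-/1 m)))))
    double : ∀ m → + (m ℕ.+ m) / 1 ≡ (+ m / 1) ℚ.+ (+ m / 1)
    double m = +-homo m m

  halving : ∀ i → B ℕ.+ B ℕ.≤ i → t (suc i) ℚ.+ t (suc i) ℚ.≤ t i
  halving i 2B≤i = begin
    (t i ℚ.* b) ℚ.* r ℚ.+ (t i ℚ.* b) ℚ.* r
      ≡⟨ half-term (t i) b r ⟩
    t i ℚ.* ((b ℚ.+ b) ℚ.* r)
      ≤⟨ *-monoʳ (0≤t i) (*-monoˡ (0≤/suc 1 i) (2b≤ (suc i) (ℕ.m≤n⇒m≤1+n 2B≤i))) ⟩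
    t i ℚ.* ((+ suc i / 1) ℚ.* r)
      ≡⟨ cong (t i ℚ.*_) (*-/suc i) ⟩
    t i ℚ.* 1ℚ
      ≡⟨ ℚ.*-identityʳ (t i) ⟩
    t i ∎
    where
    open ℚ.≤-Reasoning
    r = + 1 / suc i

  N₀ : ℕ
  N₀ = B ℕ.+ B

  decay : ∀ j → (+ suc j / 1) ℚ.* t (j ℕ.+ N₀) ℚ.≤ t N₀
  decay zero    = ℚ.≤-reflexive (ℚ.*-identityˡ (t N₀))
  decay (suc j) = begin
    (+ suc (suc j) / 1) ℚ.* u
      ≡⟨ cong (ℚ._* u) (+-/1 (suc j)) ⟩
    (s ℚ.+ 1ℚ) ℚ.* u
      ≤⟨ *-monoˡ (0≤t (suc j ℕ.+ N₀)) (ℚ.+-monoʳ-≤ s (/1-mono (ℕ.s≤s (ℕ.z≤n {j})))) ⟩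
    (s ℚ.+ s) ℚ.* u
      ≡⟨ double-product s u ⟩
    s ℚ.* (u ℚ.+ u)
      ≤⟨ *-monoʳ (0≤/suc (suc j) 0) (halving (j ℕ.+ N₀) (ℕ.m≤n+m N₀ j)) ⟩
    s ℚ.* t (j ℕ.+ N₀)
      ≤⟨ decay j ⟩
    t N₀ ∎
    where
    open ℚ.≤-Reasoning
    s = + suc j / 1
    u = t (suc j ℕ.+ N₀)

  tail : ∀ q → ℚ.∣ q ∣ ℚ.≤ b → ∀ K → N₀ ℕ.≤ K → ∀ j →
    ℚ.∣ expSum q (j ℕ.+ K) ℚ.- expSum q K ∣ ℚ.+ t (j ℕ.+ K) ℚ.≤ t K
  tail q q≤b K N₀≤K zero    = ℚ.≤-reflexive
    (trans (cong (λ z → ℚ.∣ z ∣ ℚ.+ t K) (ℚ.+-inverseʳ (expSum q K))) (ℚ.+-identityˡ (t K)))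
  tail q q≤b K N₀≤K (suc j) = begin
    ℚ.∣ (E ℚ.+ e) ℚ.- F ∣ ℚ.+ u
      ≡⟨ cong (λ z → ℚ.∣ z ∣ ℚ.+ u) (swap-last E e (ℚ.- F)) ⟩
    ℚ.∣ (E ℚ.- F) ℚ.+ e ∣ ℚ.+ u
      ≤⟨ ℚ.+-monoˡ-≤ u (ℚ.∣p+q∣≤∣p∣+∣q∣ (E ℚ.- F) e) ⟩
    (ℚ.∣ E ℚ.- F ∣ ℚ.+ ℚ.∣ e ∣) ℚ.+ u
      ≤⟨ ℚ.+-monoˡ-≤ u (ℚ.+-monoʳ-≤ ℚ.∣ E ℚ.- F ∣ (expTerm≤t q q≤b (suc (j ℕ.+ K)))) ⟩
    (ℚ.∣ E ℚ.- F ∣ ℚ.+ u) ℚ.+ u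
      ≡⟨ ℚ.+-assoc ℚ.∣ E ℚ.- F ∣ u u ⟩
    ℚ.∣ E ℚ.- F ∣ ℚ.+ (u ℚ.+ u)
      ≤⟨ ℚ.+-monoʳ-≤ ℚ.∣ E ℚ.- F ∣ (halving (j ℕ.+ K) (ℕ.≤-trans N₀≤K (ℕ.m≤n+m K j))) ⟩
    ℚ.∣ E ℚ.- F ∣ ℚ.+ t (j ℕ.+ K)
      ≤⟨ tail q q≤b K N₀≤K j ⟩
    t K ∎
    where
    open ℚ.≤-Reasoning
    E = expSum q (j ℕ.+ K)
    e = expTerm q (suc (j ℕ.+ K))
    F = expSum q K
    u = t (suc (j ℕ.+ K))

  small : ∀ ε → 0ℚ ℚ.< ε → ∃ λ K → N₀ ℕ.≤ K × t K ℚ.≤ ε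
  small ε 0<ε = j ℕ.+ N₀ , ℕ.m≤n+m N₀ j ,
    ℚ.*-cancelˡ-≤-pos s {{ℚ.positive 0<s}} (begin
      s ℚ.* t (j ℕ.+ N₀)  ≤⟨ decay j ⟩
      t N₀                ≡⟨ ℚ.+-identityʳ (t N₀) ⟨
      t N₀ ℚ.+ 0ℚ         ≤⟨ ℚ.+-monoʳ-≤ (t N₀) (ℚ.<⇒≤ 0<1) ⟩
      t N₀ ℚ.+ 1ℚ         ≡⟨ εc≡ ⟨
      ε ℚ.* c             ≤⟨ *-monoʳ (ℚ.<⇒≤ 0<ε) (ℚ.≤-trans c≤j (/1-mono (ℕ.n≤1+n j))) ⟩
      ε ℚ.* s             ≡⟨ ℚ.*-comm ε s ⟩
      s ℚ.* ε             ∎)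
    where
    open ℚ.≤-Reasoning
    scaled = scale-ε ε (t N₀ ℚ.+ 1ℚ) 0<ε (ℚ.+-mono-≤-< (0≤t N₀) 0<1)
    c = proj₁ scaled
    εc≡ : ε ℚ.* c ≡ t N₀ ℚ.+ 1ℚ
    εc≡ = proj₂ (proj₂ scaled)
    j = proj₁ (archimedean c)
    c≤j : c ℚ.≤ + j / 1
    c≤j = proj₂ (archimedean c)
    s = + suc j / 1
    0<s : 0ℚ ℚ.< s
    0<s = ℚ.<-≤-trans 0<1 (/1-mono (ℕ.s≤s (ℕ.z≤n {j})))

exp-cauchy : ∀ x → Cauchy x → Cauchy (λ n → expSum (x n) n)
exp-cauchy x cx =
  cauchy-scale (λ n → expSum (x n) n) (1ℚ ℚ.+ (1ℚ ℚ.+ 1ℚ)) (0<+ 0<1 (0<+ 0<1 0<1)) step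
  where
  bx = bounded x cx
  M  = proj₁ (proj₂ (proj₂ bx))
  B  = proj₁ (archimedean (proj₁ bx))

  open ExpTail B

  ∣x∣≤b : ∀ n → M ℕ.≤ n → ℚ.∣ x n ∣ ℚ.≤ b
  ∣x∣≤b n M≤n = ℚ.≤-trans (proj₂ (proj₂ (proj₂ bx)) n M≤n) (proj₂ (archimedean (proj₁ bx)))

  truncate : ∀ q → ℚ.∣ q ∣ ℚ.≤ b → ∀ K → N₀ ℕ.≤ K → ∀ n → K ℕ.≤ n →
    ℚ.∣ expSum q n ℚ.- expSum q K ∣ ℚ.≤ t K
  truncate q q≤b K N₀≤K n K≤n = subst (λ n → ℚ.∣ expSum q n ℚ.- expSum q K ∣ ℚ.≤ t K)
    (ℕ.m∸n+n≡m K≤n)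
    (ℚ.≤-trans (subst (ℚ._≤ d ℚ.+ t (j ℕ.+ K)) (ℚ.+-identityʳ d) (ℚ.+-monoʳ-≤ d (0≤t (j ℕ.+ K))))
      (tail q q≤b K N₀≤K j))
    where
    j = n ℕ.∸ K
    d = ℚ.∣ expSum q (j ℕ.+ K) ℚ.- expSum q K ∣

  step : ∀ ε → 0ℚ ℚ.< ε → ∃ λ N → ∀ m n → N ℕ.≤ m → N ℕ.≤ n →
    ℚ.∣ expSum (x m) m ℚ.- expSum (x n) n ∣ ℚ.≤ (1ℚ ℚ.+ (1ℚ ℚ.+ 1ℚ)) ℚ.* ε
  step ε 0<ε = (M ⊔ K) ⊔ N , λ m n N≤m N≤n →
    let MK≤m = ℕ.m⊔n≤o⇒m≤o (M ⊔ K) N N≤m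
        MK≤n = ℕ.m⊔n≤o⇒m≤o (M ⊔ K) N N≤n
    in begin
    ℚ.∣ E m ℚ.- E n ∣
      ≤⟨ triangle (E m) (F m) (E n) ⟩
    ℚ.∣ E m ℚ.- F m ∣ ℚ.+ ℚ.∣ F m ℚ.- E n ∣
      ≤⟨ ℚ.+-mono-≤ (near m (ℕ.m⊔n≤o⇒m≤o M K MK≤m) (ℕ.m⊔n≤o⇒n≤o M K MK≤m))
                    (triangle (F m) (F n) (E n)) ⟩
    ε ℚ.+ (ℚ.∣ F m ℚ.- F n ∣ ℚ.+ ℚ.∣ F n ℚ.- E n ∣)
      ≤⟨ ℚ.+-monoʳ-≤ ε (ℚ.+-mono-≤
           (p m n (ℕ.m⊔n≤o⇒n≤o (M ⊔ K) N N≤m) (ℕ.m⊔n≤o⇒n≤o (M ⊔ K) N N≤n))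
           (subst (ℚ._≤ ε) (∣-∣-comm (E n) (F n))
             (near n (ℕ.m⊔n≤o⇒m≤o M K MK≤n) (ℕ.m⊔n≤o⇒n≤o M K MK≤n)))) ⟩
    ε ℚ.+ (ε ℚ.+ ε)
      ≡⟨ thrice ε ⟩
    (1ℚ ℚ.+ (1ℚ ℚ.+ 1ℚ)) ℚ.* ε ∎
    where
    open ℚ.≤-Reasoning
    K = proj₁ (small ε 0<ε)
    E F : ℕ → ℚ
    E n = expSum (x n) n
    F n = expSum (x n) K
    close : ∃ λ N → ∀ m n → N ℕ.≤ m → N ℕ.≤ n → ℚ.∣ F m ℚ.- F n ∣ ℚ.≤ ε
    close = expSum-cauchy x cx K ε 0<ε
    N = proj₁ close
    p = proj₂ close
    near : ∀ n → M ℕ.≤ n → K ℕ.≤ n → ℚ.∣ E n ℚ.- F n ∣ ℚ.≤ ε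
    near n M≤n K≤n = ℚ.≤-trans
      (truncate (x n) (∣x∣≤b n M≤n) K (proj₁ (proj₂ (small ε 0<ε))) n K≤n)
      (proj₂ (proj₂ (small ε 0<ε)))

-- The diagonal n ↦ Σ_{i ≤ n} (xₙ)ⁱ / i! represents Σ_i xⁱ / i!, because the
-- series converges uniformly on bounded sets.
exp : ℝ → ℝ
exp x = mkℝ (λ n → expSum (seq x n) n) (exp-cauchy (seq x) (cauchy x))

------------------------------------------------------------------------
-- Monotone submodular functions on the ground set Ω = Fin m

NonNegative Monotone Submodular : ∀ {m} → (Subset m → ℝ) → Set
NonNegative f = ∀ S → 0ℝ ≤ f S
Monotone    f = ∀ S T → S ⊆ T → f S ≤ f T
Submodular  f = ∀ S T → f (S ∪ T) + f (S ∩ T) ≤ f S + f T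

record Objective (m : ℕ) : Set where
  field
    f           : Subset m → ℝ
    nonNegative : NonNegative f
    monotone    : Monotone f
    submodular  : Submodular f

------------------------------------------------------------------------
-- Online algorithms with free disposal

-- The elements that have arrived after t rounds, the latest one first.  A
-- set of arrived elements is given by a subset of the t positions.
History : ℕ → ℕ → Set
History m t = Vec (Fin m) t

elements : ∀ {m t} → History m t → Subset t → Subset m
elements []       []            = ⊥
elements (u ∷ us) (inside  ∷ S) = ⁅ u ⁆ ∪ elements us S
elements (u ∷ us) (outside ∷ S) = elements us S

-- The rule applied in each round.  It is given the names of the elements
-- that have arrived (as natural numbers, so that the size of Ω is not
-- revealed), the values of f on all sets of arrived elements, and the
-- current solution S.  It answers which elements of S are kept and whether
-- the new element is included.
Rule : Set
Rule = ∀ {t} → Vec ℕ (suc t) → (Subset (suc t) → ℝ) → Subset t → Subset t × Side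

oracle : ∀ {m t} → Objective m → History m t → Subset t → ℝ
oracle I us S = Objective.f I (elements us S)

-- Only members of S can be kept: rejected and removed elements are lost.
solution : Rule → ∀ {m t} → Objective m → History m t → Subset t
solution π I []       = []
solution π I (u ∷ us) =
  let S           = solution π I us
      kept , side = π (map toℕ (u ∷ us)) (oracle I (u ∷ us)) S
  in side ∷ (kept ∩ S)

record OnlineAlgorithm (k : ℕ) : Set where
  field
    rule     : Rule
    feasible : ∀ {m t} (I : Objective m) (us : History m t) → Unique us →
               ∣ solution rule I us ∣ ℕ.≤ k

  output : ∀ {m t} → Objective m → History m t → Subset t
  output = solution rule

  value : ∀ {m t} → Objective m → History m t → ℝ
  value I us = oracle I us (output I us)

open OnlineAlgorithm public

StrictlyMonotone : ∀ {k} → OnlineAlgorithm k → Set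
StrictlyMonotone A = ∀ {m t} (I : Objective m) u (us : History m t) → Unique (u ∷ us) →
  head (output A I (u ∷ us)) ≡ inside → value A I us < value A I (u ∷ us)

IsOPT : ∀ {m t} → ℕ → Objective m → History m t → Subset t → Set
IsOPT k I us OPT = ∣ OPT ∣ ℕ.≤ k ×
  (∀ T → ∣ T ∣ ℕ.≤ k → oracle I us T ≤ oracle I us OPT)

HasCompetitiveRatio : ∀ {k} → OnlineAlgorithm k → ℝ → Set
HasCompetitiveRatio {k} A r = ∀ {m t} (I : Objective m) (us : History m t) → Unique us →
  ∀ OPT → IsOPT k I us OPT → r * oracle I us OPT ≤ value A I us

module Submission where

-- The adversary uses a coverage function on n rows of κ points, where a point of
-- row j weighs (1 + h)ʲ, and capacity k = κ + n.  In block j it presents the κ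
-- points of row j as elements covering one point each (copies), and then one
-- summary: an element that covers exactly what the algorithm covers at that
-- moment.  A summary has no marginal value, so a strictly monotone algorithm
-- must reject it (rejected).  An optimal solution, however, may take the earlier
-- summaries, at most n of them, and all copies of the current row.  Let S be
-- the solution at the end of block j, y i the number of points of row i that it
-- covers, and m i the number of points of row i covered at the end of some block.
-- A ratio 1 / β then requires
--
--   κ (1 + h)ʲ + Σ_{i < j} m i (1 + h)ⁱ  ≤  β Σ_{i ≤ j} y i (1 + h)ⁱ,
--
-- while y i ≤ m i and Σ y i ≤ k.
--
-- These inequalities are contradictory for many blocks by linear programming
-- duality.  Divide by (1 + h)ʲ, write q = 1 / (1 + h), and bound the value
-- q ^ (j - i) of a covered point by the price qᴰ of its place plus the excess
-- (q ^ (j - i) - qᴰ)⁺, which is charged to m i.  What remains says that a potential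
-- linear in m grows in every block by about h (1 - β qᴰ) κ (potential-step).  The
-- coefficients of old blocks in this potential are non-positive as soon as
--
--   β Σ_d h (qᵈ - qᴰ)⁺ < 1,
--
-- so the potential is bounded by a constant times κ, a contradiction
-- (potential-overflow).  With β qᴰ just below 1 and h → 0 the left-hand side tends
-- to β - 1 - log β, so the condition becomes exp (β - 2) < β.  This is where the
-- threshold for α comes from.
--
-- To avoid logarithms, a rational β ≥ α and a rational y > β - 2 are chosen whose
-- partial exponential sums stay below β (rational-gap).  With h = y / D₀ the bound
-- (1 + h) ^ D₀ ≤ expSum y D₀ ≤ β then shows that D may be taken larger than D₀ = y / h
-- (rate).

open import Defs
open import Data.Bool.Base using (Bool; true; false)
open import Data.Fin.Base using (Fin; zero; suc; toℕ; fromℕ<; combine; remQuot)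
open import Data.Fin.Properties using (remQuot-combine; toℕ-fromℕ<; toℕ<n; toℕ-injective)
open import Data.Fin.Subset using (Subset; Side; inside; outside; ⊥; ⊤; ⁅_⁆; _∪_; _∩_; _∈_; _⊆_; ∣_∣)
open import Data.Fin.Subset.Properties
  using (x∈p∪q⁻; x∈p∪q⁺; x∈p∩q⁻; x∈p∩q⁺; p⊆p∪q; q⊆p∪q; p∩q⊆q; ∉⊥; ⊥⊆; x∈⁅x⁆; x∈⁅y⁆⇒x≡y;
         ⊆-antisym; ⊆-refl; ⊆-trans; p⊆q⇒∣p∣≤∣q∣; ∣⊥∣≡0; ∣⊤∣≡n; ∣p∣≤n; ∣⁅x⁆∣≡1)
open import Data.Integer.Base using (+_)
open import Data.Nat.Base as ℕ using (ℕ; zero; suc; _⊔_)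
import Data.Nat.Properties as ℕ
open import Data.Product.Base using (∃; _×_; _,_; proj₁; proj₂)
import Data.Product.Base as Product
open import Data.Rational.Base as ℚ using (ℚ; 0ℚ; 1ℚ; _/_)
import Data.Rational.Properties as ℚ
open import Data.Rational.Solver using (module +-*-Solver)
open import Data.Sum.Base using (inj₁; inj₂; [_,_]′)
open import Data.Vec.Base using (Vec; []; _∷_; lookup; here; there; head; map)
open import Data.Vec.Relation.Unary.All as All using (All; []; _∷_)
open import Data.Vec.Relation.Unary.AllPairs using ([]; _∷_)
open import Data.Vec.Relation.Unary.Unique.Propositional using (Unique)
open import Function.Base using (_∘_)
open import Relation.Binary.PropositionalEquality
  using (_≡_; _≢_; refl; sym; trans; cong; cong₂; subst; subst₂; module ≡-Reasoning)
open import Relation.Nullary.Decidable using (Dec; yes; no; from-yes)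
open import Relation.Nullary.Negation using (¬_; contradiction)

open import Algebra.Definitions.RawSemiring ℚ.+-*-rawSemiring using (_^_)
open +-*-Solver using (solve; _:+_; _:-_; _:*_; _:=_; con)

-- Rational inequalities and the exponential series

ι : ℕ → ℚ
ι n = + n / 1

-- Inequalities between rationals are reduced to ring identities: the right-hand
-- side is the left-hand side plus a term that is visibly non-negative.
≤-by : ∀ {a b} c → 0ℚ ℚ.≤ c → a ℚ.+ c ≡ b → a ℚ.≤ b
≤-by {a} c 0≤c eq = subst₂ ℚ._≤_ (ℚ.+-identityʳ a) eq (ℚ.+-monoʳ-≤ a 0≤c)

0≤+ : ∀ {p q} → 0ℚ ℚ.≤ p → 0ℚ ℚ.≤ q → 0ℚ ℚ.≤ p ℚ.+ q
0≤+ 0≤p 0≤q = ℚ.+-mono-≤ 0≤p 0≤q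

0≤1 : 0ℚ ℚ.≤ 1ℚ
0≤1 = ℚ.<⇒≤ 0<1

0≤- : ∀ {p q} → p ℚ.≤ q → 0ℚ ℚ.≤ q ℚ.- p
0≤- {p} {q} p≤q = subst (ℚ._≤ q ℚ.- p) (ℚ.+-inverseʳ p) (ℚ.+-monoˡ-≤ (ℚ.- p) p≤q)

<-by : ∀ {a b} c → 0ℚ ℚ.< c → a ℚ.+ c ≡ b → a ℚ.< b
<-by {a} c 0<c eq = subst₂ ℚ._<_ (ℚ.+-identityʳ a) eq (ℚ.+-monoʳ-< a 0<c)

0<- : ∀ {p q} → p ℚ.< q → 0ℚ ℚ.< q ℚ.- p
0<- {p} {q} p<q = subst (ℚ._< q ℚ.- p) (ℚ.+-inverseʳ p) (ℚ.+-monoˡ-< (ℚ.- p) p<q)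

p≤∣p∣ : ∀ p → p ℚ.≤ ℚ.∣ p ∣
p≤∣p∣ p with ℚ.≤-total 0ℚ p
... | inj₁ 0≤p = ℚ.≤-reflexive (sym (ℚ.0≤p⇒∣p∣≡p 0≤p))
... | inj₂ p≤0 = ℚ.≤-trans p≤0 (ℚ.0≤∣p∣ p)

∣-∣≤⇒≤ : ∀ p q {δ} → ℚ.∣ p ℚ.- q ∣ ℚ.≤ δ → p ℚ.≤ q ℚ.+ δ
∣-∣≤⇒≤ p q {δ} d≤δ = subst (ℚ._≤ q ℚ.+ δ)
  (solve 2 (λ p q → q :+ (p :- q) := p) refl p q)
  (ℚ.+-monoʳ-≤ q (ℚ.≤-trans (p≤∣p∣ (p ℚ.- q)) d≤δ))

cancel-pos : ∀ {c p q} → 0ℚ ℚ.< c → c ℚ.* p ℚ.≤ c ℚ.* q → p ℚ.≤ q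
cancel-pos {c} 0<c = ℚ.*-cancelˡ-≤-pos c {{ℚ.positive 0<c}}

0≤ι : ∀ n → 0ℚ ℚ.≤ ι n
0≤ι n = 0≤/suc n 0

0<ι : ∀ n → 0ℚ ℚ.< ι (suc n)
0<ι n = ℚ.<-≤-trans 0<1 (/1-mono (ℕ.s≤s (ℕ.z≤n {n})))

ι-+ : ∀ m n → ι (m ℕ.+ n) ≡ ι m ℚ.+ ι n
ι-+ zero    n = sym (ℚ.+-identityˡ (ι n))
ι-+ (suc m) n = trans (+-/1 (m ℕ.+ n)) (trans (cong (ℚ._+ 1ℚ) (ι-+ m n))
  (trans (swap-last (ι m) (ι n) 1ℚ) (cong (ℚ._+ ι n) (sym (+-/1 m)))))

expTerm-suc : ∀ q i → ι (suc i) ℚ.* expTerm q (suc i) ≡ expTerm q i ℚ.* q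
expTerm-suc q i = trans
  (solve 3 (λ a b c → a :* (b :* c) := b :* (a :* c)) refl
    (ι (suc i)) (expTerm q i ℚ.* q) (+ 1 / suc i))
  (trans (cong (expTerm q i ℚ.* q ℚ.*_) (*-/suc i)) (ℚ.*-identityʳ _))

0≤expTerm : ∀ {q} → 0ℚ ℚ.≤ q → ∀ i → 0ℚ ℚ.≤ expTerm q i
0≤expTerm 0≤q zero    = 0≤1
0≤expTerm 0≤q (suc i) = 0≤* (0≤* (0≤expTerm 0≤q i) 0≤q) (0≤/suc 1 i)

-- The difference quotient of yⁱ⁺¹ / (i + 1)! over [y, y + h] is a mean value of
-- its derivative yⁱ / i!, hence at least the value of the latter at y.
expTerm-step-lower : ∀ {y h} → 0ℚ ℚ.≤ y → 0ℚ ℚ.≤ h → ∀ i →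
  expTerm y (suc i) ℚ.+ h ℚ.* expTerm y i ℚ.≤ expTerm (y ℚ.+ h) (suc i)
expTerm-step-lower {y} {h} 0≤y 0≤h zero = ℚ.≤-reflexive
  (solve 2 (λ y h → (con 1ℚ :* y) :* con 1ℚ :+ h :* con 1ℚ := (con 1ℚ :* (y :+ h)) :* con 1ℚ) refl y h)
expTerm-step-lower {y} {h} 0≤y 0≤h (suc i) = cancel-pos (0<ι (suc i)) (begin
  s′ ℚ.* (e₂ ℚ.+ h ℚ.* e₁)
    ≡⟨ solve 4 (λ s e h f → s :* (e :+ h :* f) := s :* e :+ h :* (s :* f)) refl s′ e₂ h e₁ ⟩
  s′ ℚ.* e₂ ℚ.+ h ℚ.* (s′ ℚ.* e₁)
    ≡⟨ cong₂ (λ a b → a ℚ.+ h ℚ.* (b ℚ.* e₁)) (expTerm-suc y (suc i)) (+-/1 (suc i)) ⟩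
  e₁ ℚ.* y ℚ.+ h ℚ.* ((s ℚ.+ 1ℚ) ℚ.* e₁)
    ≡⟨ solve 4 (λ s e y h → e :* y :+ h :* ((s :+ con 1ℚ) :* e)
            := e :* y :+ h :* e :+ h :* (s :* e)) refl s e₁ y h ⟩
  e₁ ℚ.* y ℚ.+ h ℚ.* e₁ ℚ.+ h ℚ.* (s ℚ.* e₁)
    ≡⟨ cong (λ z → e₁ ℚ.* y ℚ.+ h ℚ.* e₁ ℚ.+ h ℚ.* z) (expTerm-suc y i) ⟩
  e₁ ℚ.* y ℚ.+ h ℚ.* e₁ ℚ.+ h ℚ.* (e₀ ℚ.* y)
    ≤⟨ ≤-by (h ℚ.* h ℚ.* e₀) (0≤* (0≤* 0≤h 0≤h) (0≤expTerm 0≤y i))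
         (solve 4 (λ e f y h → e :* y :+ h :* e :+ h :* (f :* y) :+ h :* h :* f
                             := (e :+ h :* f) :* (y :+ h)) refl e₁ e₀ y h) ⟩
  (e₁ ℚ.+ h ℚ.* e₀) ℚ.* (y ℚ.+ h)
    ≤⟨ *-monoˡ (0≤+ 0≤y 0≤h) (expTerm-step-lower 0≤y 0≤h i) ⟩
  expTerm (y ℚ.+ h) (suc i) ℚ.* (y ℚ.+ h)
    ≡⟨ expTerm-suc (y ℚ.+ h) (suc i) ⟨
  s′ ℚ.* expTerm (y ℚ.+ h) (suc (suc i)) ∎)
  where
  open ℚ.≤-Reasoning
  e₀ = expTerm y i
  e₁ = expTerm y (suc i)
  e₂ = expTerm y (suc (suc i))
  s  = ι (suc i)
  s′ = ι (suc (suc i))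

-- The matching upper bound takes the derivative at the right end y + h.
expTerm-step-upper : ∀ {y h} → 0ℚ ℚ.≤ y → 0ℚ ℚ.≤ h → ∀ i →
  expTerm (y ℚ.+ h) (suc i) ℚ.≤ expTerm y (suc i) ℚ.+ h ℚ.* expTerm (y ℚ.+ h) i
expTerm-step-upper {y} {h} 0≤y 0≤h zero = ℚ.≤-reflexive
  (solve 2 (λ y h → (con 1ℚ :* (y :+ h)) :* con 1ℚ := (con 1ℚ :* y) :* con 1ℚ :+ h :* con 1ℚ) refl y h)
expTerm-step-upper {y} {h} 0≤y 0≤h (suc i) = cancel-pos (0<ι (suc i)) (begin
  s′ ℚ.* expTerm z (suc (suc i))
    ≡⟨ expTerm-suc z (suc i) ⟩
  f₁ ℚ.* (y ℚ.+ h)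
    ≡⟨ ℚ.*-distribˡ-+ f₁ y h ⟩
  f₁ ℚ.* y ℚ.+ f₁ ℚ.* h
    ≤⟨ ℚ.+-monoˡ-≤ (f₁ ℚ.* h) (*-monoˡ 0≤y (expTerm-step-upper 0≤y 0≤h i)) ⟩
  (e₁ ℚ.+ h ℚ.* f₀) ℚ.* y ℚ.+ f₁ ℚ.* h
    ≤⟨ ≤-by (h ℚ.* h ℚ.* f₀) (0≤* (0≤* 0≤h 0≤h) (0≤expTerm (0≤+ 0≤y 0≤h) i))
         (solve 5 (λ e f g y h → (e :+ h :* f) :* y :+ g :* h :+ h :* h :* f
                             := e :* y :+ h :* g :+ h :* (f :* (y :+ h))) refl e₁ f₀ f₁ y h) ⟩
  e₁ ℚ.* y ℚ.+ h ℚ.* f₁ ℚ.+ h ℚ.* (f₀ ℚ.* z)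
    ≡⟨ cong (λ w → e₁ ℚ.* y ℚ.+ h ℚ.* f₁ ℚ.+ h ℚ.* w) (expTerm-suc z i) ⟨
  e₁ ℚ.* y ℚ.+ h ℚ.* f₁ ℚ.+ h ℚ.* (s ℚ.* f₁)
    ≡⟨ solve 5 (λ s e f y h → e :* y :+ h :* f :+ h :* (s :* f)
            := e :* y :+ h :* ((s :+ con 1ℚ) :* f)) refl s e₁ f₁ y h ⟩
  e₁ ℚ.* y ℚ.+ h ℚ.* ((s ℚ.+ 1ℚ) ℚ.* f₁)
    ≡⟨ cong₂ (λ a b → a ℚ.+ h ℚ.* (b ℚ.* f₁)) (expTerm-suc y (suc i)) (+-/1 (suc i)) ⟨
  s′ ℚ.* e₂ ℚ.+ h ℚ.* (s′ ℚ.* f₁)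
    ≡⟨ solve 4 (λ s e h f → s :* (e :+ h :* f) := s :* e :+ h :* (s :* f)) refl s′ e₂ h f₁ ⟨
  s′ ℚ.* (e₂ ℚ.+ h ℚ.* f₁) ∎)
  where
  open ℚ.≤-Reasoning
  z  = y ℚ.+ h
  f₀ = expTerm z i
  f₁ = expTerm z (suc i)
  e₁ = expTerm y (suc i)
  e₂ = expTerm y (suc (suc i))
  s  = ι (suc i)
  s′ = ι (suc (suc i))

expTerm-mono : ∀ {y z} → 0ℚ ℚ.≤ y → y ℚ.≤ z → ∀ i → expTerm y i ℚ.≤ expTerm z i
expTerm-mono 0≤y y≤z zero    = ℚ.≤-refl
expTerm-mono 0≤y y≤z (suc i) = *-monoˡ (0≤/suc 1 i)
  (ℚ.≤-trans (*-monoˡ 0≤y (expTerm-mono 0≤y y≤z i))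
             (*-monoʳ (0≤expTerm (ℚ.≤-trans 0≤y y≤z) i) y≤z))

expSum-mono : ∀ {y z} → 0ℚ ℚ.≤ y → y ℚ.≤ z → ∀ n → expSum y n ℚ.≤ expSum z n
expSum-mono 0≤y y≤z zero    = ℚ.≤-refl
expSum-mono 0≤y y≤z (suc n) = ℚ.+-mono-≤ (expSum-mono 0≤y y≤z n) (expTerm-mono 0≤y y≤z (suc n))

expSum-suc : ∀ {y} → 0ℚ ℚ.≤ y → ∀ n → expSum y n ℚ.≤ expSum y (suc n)
expSum-suc {y} 0≤y n = ≤-by (expTerm y (suc n)) (0≤expTerm 0≤y (suc n)) refl

expSum-step-lower : ∀ {y h} → 0ℚ ℚ.≤ y → 0ℚ ℚ.≤ h → ∀ n →
  expSum y (suc n) ℚ.+ h ℚ.* expSum y n ℚ.≤ expSum (y ℚ.+ h) (suc n)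
expSum-step-lower {y} {h} 0≤y 0≤h zero = subst (ℚ._≤ expSum (y ℚ.+ h) 1)
  (sym (ℚ.+-assoc 1ℚ (expTerm y 1) (h ℚ.* 1ℚ)))
  (ℚ.+-monoʳ-≤ 1ℚ (expTerm-step-lower 0≤y 0≤h zero))
expSum-step-lower {y} {h} 0≤y 0≤h (suc n) = subst (ℚ._≤ expSum (y ℚ.+ h) (suc (suc n)))
  (solve 5 (λ a b c d h → (a :+ h :* b) :+ (c :+ h :* d) := (a :+ c) :+ h :* (b :+ d)) refl
    (expSum y (suc n)) (expSum y n) (expTerm y (suc (suc n))) (expTerm y (suc n)) h)
  (ℚ.+-mono-≤ (expSum-step-lower 0≤y 0≤h n) (expTerm-step-lower 0≤y 0≤h (suc n)))

expSum-step-upper : ∀ {y h} → 0ℚ ℚ.≤ y → 0ℚ ℚ.≤ h → ∀ n →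
  expSum (y ℚ.+ h) (suc n) ℚ.≤ expSum y (suc n) ℚ.+ h ℚ.* expSum (y ℚ.+ h) n
expSum-step-upper {y} {h} 0≤y 0≤h zero = subst (expSum (y ℚ.+ h) 1 ℚ.≤_)
  (sym (ℚ.+-assoc 1ℚ (expTerm y 1) (h ℚ.* 1ℚ)))
  (ℚ.+-monoʳ-≤ 1ℚ (expTerm-step-upper 0≤y 0≤h zero))
expSum-step-upper {y} {h} 0≤y 0≤h (suc n) = subst (expSum (y ℚ.+ h) (suc (suc n)) ℚ.≤_)
  (solve 5 (λ a b c d h → (a :+ h :* b) :+ (c :+ h :* d) := (a :+ c) :+ h :* (b :+ d)) refl
    (expSum y (suc n)) (expSum z n) (expTerm y (suc (suc n))) (expTerm z (suc n)) h)
  (ℚ.+-mono-≤ (expSum-step-upper 0≤y 0≤h n) (expTerm-step-upper 0≤y 0≤h (suc n)))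
  where z = y ℚ.+ h

-- One factor 1 + h is absorbed by moving the argument of the exponential sum by
-- h and adding one more term, so n factors fit below the first n + 1 terms.
pow≤expSum : ∀ {h} → 0ℚ ℚ.≤ h → ∀ n → (1ℚ ℚ.+ h) ^ n ℚ.≤ expSum (ι n ℚ.* h) n
pow≤expSum 0≤h zero = ℚ.≤-refl
pow≤expSum {h} 0≤h (suc n) = begin
  (1ℚ ℚ.+ h) ℚ.* (1ℚ ℚ.+ h) ^ n
    ≤⟨ *-monoʳ (0≤+ 0≤1 0≤h) (pow≤expSum 0≤h n) ⟩
  (1ℚ ℚ.+ h) ℚ.* expSum y n
    ≡⟨ solve 2 (λ h e → (con 1ℚ :+ h) :* e := e :+ h :* e) refl h (expSum y n) ⟩
  expSum y n ℚ.+ h ℚ.* expSum y n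
    ≤⟨ ℚ.+-monoˡ-≤ (h ℚ.* expSum y n) (expSum-suc 0≤y n) ⟩
  expSum y (suc n) ℚ.+ h ℚ.* expSum y n
    ≤⟨ expSum-step-lower 0≤y 0≤h n ⟩
  expSum (y ℚ.+ h) (suc n)
    ≡⟨ cong (λ z → expSum z (suc n)) (trans
         (solve 2 (λ a h → a :* h :+ h := (a :+ con 1ℚ) :* h) refl (ι n) h)
         (cong (ℚ._* h) (sym (+-/1 n)))) ⟩
  expSum (ι (suc n) ℚ.* h) (suc n) ∎
  where
  open ℚ.≤-Reasoning
  y = ι n ℚ.* h
  0≤y : 0ℚ ℚ.≤ y
  0≤y = 0≤* (0≤ι n) 0≤h

-- A truncated form of exp (y + h) ≤ exp y / (1 - h).  As the number of terms is
-- the same on both sides, no estimate of the tail of the series is involved.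
expSum-shift : ∀ {y h} → 0ℚ ℚ.≤ y → 0ℚ ℚ.≤ h → ∀ n →
  (1ℚ ℚ.- h) ℚ.* expSum (y ℚ.+ h) n ℚ.≤ expSum y n
expSum-shift {y} {h} 0≤y 0≤h zero = ≤-by h 0≤h
  (solve 1 (λ h → (con 1ℚ :- h) :* con 1ℚ :+ h := con 1ℚ) refl h)
expSum-shift {y} {h} 0≤y 0≤h (suc n) = begin
  (1ℚ ℚ.- h) ℚ.* (F ℚ.+ f)
    ≤⟨ ≤-by (h ℚ.* f) (0≤* 0≤h (0≤expTerm (0≤+ 0≤y 0≤h) (suc n)))
         (solve 3 (λ h F f → (con 1ℚ :- h) :* (F :+ f) :+ h :* f := (F :+ f) :- h :* F) refl h F f) ⟩
  (F ℚ.+ f) ℚ.- h ℚ.* F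
    ≤⟨ ℚ.+-monoˡ-≤ (ℚ.- (h ℚ.* F)) (expSum-step-upper 0≤y 0≤h n) ⟩
  (expSum y (suc n) ℚ.+ h ℚ.* F) ℚ.- h ℚ.* F
    ≡⟨ solve 2 (λ a b → (a :+ b) :- b := a) refl (expSum y (suc n)) (h ℚ.* F) ⟩
  expSum y (suc n) ∎
  where
  open ℚ.≤-Reasoning
  F = expSum (y ℚ.+ h) n
  f = expTerm (y ℚ.+ h) (suc n)

expSum-0 : ∀ n → expSum 0ℚ n ≡ 1ℚ
expSum-0 zero    = refl
expSum-0 (suc n) = trans (cong₂ ℚ._+_ (expSum-0 n)
  (solve 2 (λ e r → (e :* con 0ℚ) :* r := con 0ℚ) refl (expTerm 0ℚ n) (+ 1 / suc n)))
  (ℚ.+-identityʳ 1ℚ)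

-- A rational gap from the hypothesis on α

_eventually≤_ : (ℕ → ℚ) → ℚ → Set
f eventually≤ c = ∃ λ M → ∀ n → M ℕ.≤ n → f n ℚ.≤ c

3ℚ 12ℚ : ℚ
3ℚ  = + 3 / 1
12ℚ = + 12 / 1

-- Raising a - 2 by at most 3 τ multiplies its exponential by at most
-- 1 / (1 - 3 τ); because 3 β τ ≤ ε, the gap pays for that factor.
expSum-gap : ∀ {a β τ ε} n → 0ℚ ℚ.< τ → 12ℚ ℚ.* τ ℚ.≤ 1ℚ → 3ℚ ℚ.* β ℚ.* τ ℚ.≤ ε →
  + 9 / 4 ℚ.≤ β → a ℚ.≤ β → β ℚ.≤ a ℚ.+ τ ℚ.+ τ →
  expSum (a ℚ.+ (ℚ.- 1ℚ) ℚ.* (+ 2 / 1)) n ℚ.+ ε ℚ.≤ a →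
  expSum ((β ℚ.- (+ 2 / 1)) ℚ.+ τ) n ℚ.≤ β
expSum-gap {a} {β} {τ} {ε} n 0<τ 12τ≤1 3βτ≤ε 9/4≤β a≤β β≤a+2τ gap = cancel-pos 0<1-3τ (begin
  (1ℚ ℚ.- 3ℚ ℚ.* τ) ℚ.* expSum y n
    ≤⟨ *-monoʳ (ℚ.<⇒≤ 0<1-3τ) (expSum-mono 0≤y y≤x+3τ n) ⟩
  (1ℚ ℚ.- 3ℚ ℚ.* τ) ℚ.* expSum (x ℚ.+ 3ℚ ℚ.* τ) n
    ≤⟨ expSum-shift 0≤x (0≤* (0≤ι 3) 0≤τ) n ⟩
  expSum x n
    ≡⟨ solve 2 (λ e f → e := (e :+ f) :- f) refl (expSum x n) ε ⟩
  (expSum x n ℚ.+ ε) ℚ.- ε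
    ≤⟨ ℚ.+-monoˡ-≤ (ℚ.- ε) gap ⟩
  a ℚ.- ε
    ≤⟨ ℚ.+-mono-≤ {a} {β} {ℚ.- ε} {ℚ.- (3ℚ ℚ.* β ℚ.* τ)} a≤β (ℚ.neg-antimono-≤ 3βτ≤ε) ⟩
  β ℚ.- 3ℚ ℚ.* β ℚ.* τ
    ≡⟨ solve 2 (λ b t → b :- con 3ℚ :* b :* t := (con 1ℚ :- con 3ℚ :* t) :* b) refl β τ ⟩
  (1ℚ ℚ.- 3ℚ ℚ.* τ) ℚ.* β ∎)
  where
  open ℚ.≤-Reasoning
  x y : ℚ
  x = a ℚ.+ (ℚ.- 1ℚ) ℚ.* (+ 2 / 1)
  y = (β ℚ.- (+ 2 / 1)) ℚ.+ τ
  0≤τ = ℚ.<⇒≤ 0<τ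

  0<1-3τ : 0ℚ ℚ.< 1ℚ ℚ.- 3ℚ ℚ.* τ
  0<1-3τ = 0<- (ℚ.<-≤-trans (<-by {3ℚ ℚ.* τ} {12ℚ ℚ.* τ} (+ 9 / 1 ℚ.* τ) (0<* (0<ι 8) 0<τ)
    (solve 1 (λ τ → con 3ℚ :* τ :+ con (+ 9 / 1) :* τ := con 12ℚ :* τ) refl τ)) 12τ≤1)

  slack : 0ℚ ℚ.≤ a ℚ.+ τ ℚ.+ τ ℚ.- β
  slack = 0≤- β≤a+2τ

  y≤x+3τ : y ℚ.≤ x ℚ.+ 3ℚ ℚ.* τ
  y≤x+3τ = ≤-by (a ℚ.+ τ ℚ.+ τ ℚ.- β) slack
    (solve 3 (λ b t a → (b :- con (+ 2 / 1)) :+ t :+ (a :+ t :+ t :- b)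
                     := (a :+ con ((ℚ.- 1ℚ) ℚ.* (+ 2 / 1))) :+ con 3ℚ :* t) refl β τ a)

  -- From 2 τ ≤ 1 / 6 and β ≥ 9 / 4, a ≥ β - 2 τ stays above 2.
  0≤x : 0ℚ ℚ.≤ x
  0≤x = subst (0ℚ ℚ.≤_)
    (solve 3 (λ b t a → (a :+ t :+ t :- b) :+ ((b :- con (+ 9 / 4))
                          :+ (con (+ 1 / 6) :* (con 1ℚ :- con 12ℚ :* t) :+ con (+ 1 / 12)))
        := a :+ con ((ℚ.- 1ℚ) ℚ.* (+ 2 / 1))) refl β τ a)
    (0≤+ slack (0≤+ (0≤- 9/4≤β) (0≤+ (0≤* {+ 1 / 6} (0≤/suc 1 5) (0≤- 12τ≤1)) (0≤/suc 1 11))))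

  0≤y : 0ℚ ℚ.≤ y
  0≤y = 0≤+ (0≤- (ℚ.≤-trans (from-yes (+ 2 / 1 ℚ.≤? + 9 / 4)) 9/4≤β)) 0≤τ

small-scale : ∀ B ε → 0ℚ ℚ.< B → 0ℚ ℚ.< ε → ∃ λ τ →
  0ℚ ℚ.< τ × 12ℚ ℚ.* τ ℚ.≤ 1ℚ × 3ℚ ℚ.* B ℚ.* τ ℚ.≤ ε
small-scale B ε 0<B 0<ε =
  let τ , 0<τ , Cτ≡ε = scale-ε (3ℚ ℚ.* B ℚ.+ 12ℚ ℚ.* ε) ε
        (0<+ (0<* {3ℚ} (0<ι 2) 0<B) (0<* {12ℚ} (0<ι 11) 0<ε)) 0<ε
      0≤τ = ℚ.<⇒≤ 0<τ
  in τ , 0<τ , upper τ 0≤τ Cτ≡ε , lower τ 0≤τ Cτ≡ε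
  where
  module _ (τ : ℚ) (0≤τ : 0ℚ ℚ.≤ τ) (Cτ≡ε : (3ℚ ℚ.* B ℚ.+ 12ℚ ℚ.* ε) ℚ.* τ ≡ ε) where
    upper : 12ℚ ℚ.* τ ℚ.≤ 1ℚ
    upper = cancel-pos 0<ε (≤-by (3ℚ ℚ.* B ℚ.* τ) (0≤* (0≤* {3ℚ} (0≤ι 3) (ℚ.<⇒≤ 0<B)) 0≤τ)
        (trans (solve 3 (λ ε τ b → ε :* (con 12ℚ :* τ) :+ con 3ℚ :* b :* τ
                                := (con 3ℚ :* b :+ con 12ℚ :* ε) :* τ) refl ε τ B)
          (trans Cτ≡ε (sym (ℚ.*-identityʳ ε)))))
    lower : 3ℚ ℚ.* B ℚ.* τ ℚ.≤ ε
    lower = ≤-by (12ℚ ℚ.* ε ℚ.* τ) (0≤* (0≤* {12ℚ} (0≤ι 12) (ℚ.<⇒≤ 0<ε)) 0≤τ)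
        (trans (sym (ℚ.*-distribʳ-+ τ (3ℚ ℚ.* B) (12ℚ ℚ.* ε))) Cτ≡ε)

rational-bound : ∀ x → Cauchy x → ∀ τ → 0ℚ ℚ.< τ → ∃ λ β → ∃ λ N →
  ∀ n → N ℕ.≤ n → x n ℚ.≤ β × β ℚ.≤ x n ℚ.+ τ ℚ.+ τ
rational-bound x c τ 0<τ with c τ 0<τ
... | N , close = x N ℚ.+ τ , N , λ n N≤n →
  ∣-∣≤⇒≤ (x n) (x N) (close n N N≤n ℕ.≤-refl) ,
  ℚ.+-monoˡ-≤ τ (∣-∣≤⇒≤ (x N) (x n) (close N n ℕ.≤-refl N≤n))

-- A rational form of exp (α - 2) < α.  As the bound β - 2 < y is strict, it leaves
-- room for the discretisation errors of order h below.
RationalGap : (ℕ → ℚ) → Set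
RationalGap a = ∃ λ β → ∃ λ y →
  0ℚ ℚ.< y × β ℚ.< y ℚ.+ (+ 2 / 1) × a eventually≤ β × expSum y eventually≤ β

-- If α ≤ 9 / 4, then α - 2 may be negative, where the estimates of the exponential
-- sum do not apply.  As a ratio 1 / α implies the ratio 4 / 9, it suffices to refute
-- the latter, and exp ½ ≤ 2 < 9 / 4 leaves the room for y = ½ > 9 / 4 - 2.
gap-below-9/4 : ∀ a → a eventually≤ (+ 9 / 4) → RationalGap a
gap-below-9/4 a a≤9/4 = + 9 / 4 , ℚ.½ , from-yes (0ℚ ℚ.<? ℚ.½)
  , from-yes (+ 9 / 4 ℚ.<? ℚ.½ ℚ.+ (+ 2 / 1)) , a≤9/4
  , 0 , λ n _ → cancel-pos {ℚ.½} (from-yes (0ℚ ℚ.<? ℚ.½))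
      (ℚ.≤-trans (expSum-shift {0ℚ} {ℚ.½} ℚ.≤-refl (from-yes (0ℚ ℚ.≤? ℚ.½)) n)
      (ℚ.≤-trans (ℚ.≤-reflexive (expSum-0 n)) (from-yes (1ℚ ℚ.≤? ℚ.½ ℚ.* (+ 9 / 4)))))

gap-above-9/4 : ∀ a β τ ε N → + 9 / 4 ℚ.< β → 0ℚ ℚ.< τ →
  12ℚ ℚ.* τ ℚ.≤ 1ℚ → 3ℚ ℚ.* β ℚ.* τ ℚ.≤ ε →
  (∀ n → N ℕ.≤ n → (a n ℚ.≤ β × β ℚ.≤ a n ℚ.+ τ ℚ.+ τ) ×
    expSum (a n ℚ.+ (ℚ.- 1ℚ) ℚ.* (+ 2 / 1)) n ℚ.+ ε ℚ.≤ a n) → RationalGap a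
gap-above-9/4 a β τ ε N 9/4<β 0<τ 12τ≤1 3βτ≤ε near = β , (β ℚ.- (+ 2 / 1)) ℚ.+ τ
  , 0<+ (0<- (ℚ.<-trans (from-yes (+ 2 / 1 ℚ.<? + 9 / 4)) 9/4<β)) 0<τ
  , <-by τ 0<τ (solve 2 (λ b t → b :+ t := (b :- con (+ 2 / 1) :+ t) :+ con (+ 2 / 1)) refl β τ)
  , (N , λ n N≤n → proj₁ (proj₁ (near n N≤n)))
  , N , λ n N≤n → expSum-gap {a n} {β} {τ} {ε} n 0<τ 12τ≤1 3βτ≤ε (ℚ.<⇒≤ 9/4<β)
      (proj₁ (proj₁ (near n N≤n))) (proj₂ (proj₁ (near n N≤n))) (proj₂ (near n N≤n))

bound+1 : ∀ {a B β τ} → ℚ.∣ a ∣ ℚ.≤ B → 0ℚ ℚ.< τ → 12ℚ ℚ.* τ ℚ.≤ 1ℚ →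
  β ℚ.≤ a ℚ.+ τ ℚ.+ τ → β ℚ.≤ B ℚ.+ 1ℚ
bound+1 {a} {B} {β} {τ} ∣a∣≤B 0<τ 12τ≤1 β≤a+2τ = begin
  β                 ≤⟨ β≤a+2τ ⟩
  a ℚ.+ τ ℚ.+ τ     ≡⟨ ℚ.+-assoc a τ τ ⟩
  a ℚ.+ (τ ℚ.+ τ)   ≤⟨ ℚ.+-mono-≤ {a} {B} {τ ℚ.+ τ} {12ℚ ℚ.* τ} (ℚ.≤-trans (p≤∣p∣ a) ∣a∣≤B)
                        (≤-by (+ 10 / 1 ℚ.* τ) (0≤* {+ 10 / 1} (0≤ι 10) (ℚ.<⇒≤ 0<τ))
                          (solve 1 (λ τ → τ :+ τ :+ con (+ 10 / 1) :* τ := con 12ℚ :* τ) refl τ)) ⟩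
  B ℚ.+ 12ℚ ℚ.* τ   ≤⟨ ℚ.+-monoʳ-≤ B 12τ≤1 ⟩
  B ℚ.+ 1ℚ          ∎
  where open ℚ.≤-Reasoning

rational-gap : ∀ α → exp (α - 2ℝ) < α → RationalGap (seq α)
rational-gap α (ε , 0<ε , N₀ , gap) = scaled (small-scale (B ℚ.+ 1ℚ) ε (0<+ (proj₁ (proj₂ bnd)) 0<1) 0<ε)
  where
  a = seq α
  bnd = bounded a (cauchy α)
  B = proj₁ bnd
  N₁ = proj₁ (proj₂ (proj₂ bnd))

  scaled : (∃ λ τ → 0ℚ ℚ.< τ × 12ℚ ℚ.* τ ℚ.≤ 1ℚ × 3ℚ ℚ.* (B ℚ.+ 1ℚ) ℚ.* τ ℚ.≤ ε) → RationalGap a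
  scaled (τ , 0<τ , 12τ≤1 , 3Bτ≤ε) = located (rational-bound a (cauchy α) τ 0<τ)
    where
    located : (∃ λ β → ∃ λ N → ∀ n → N ℕ.≤ n → a n ℚ.≤ β × β ℚ.≤ a n ℚ.+ τ ℚ.+ τ) → RationalGap a
    located (β , N₂ , near) = cases (β ℚ.≤? + 9 / 4)
      where
      β≤B+1 : β ℚ.≤ B ℚ.+ 1ℚ
      β≤B+1 = bound+1 {a (N₁ ⊔ N₂)}
        (proj₂ (proj₂ (proj₂ bnd)) (N₁ ⊔ N₂) (ℕ.m≤m⊔n N₁ N₂)) 0<τ 12τ≤1
        (proj₂ (near (N₁ ⊔ N₂) (ℕ.m≤n⊔m N₁ N₂)))

      cases : Dec (β ℚ.≤ + 9 / 4) → RationalGap a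
      cases (yes β≤9/4) = gap-below-9/4 a (N₂ , λ n N₂≤n → ℚ.≤-trans (proj₁ (near n N₂≤n)) β≤9/4)
      cases (no β≰9/4)  = gap-above-9/4 a β τ ε (N₀ ⊔ N₂) (ℚ.≰⇒> β≰9/4) 0<τ 12τ≤1
        (ℚ.≤-trans (*-monoˡ (ℚ.<⇒≤ 0<τ) (*-monoʳ {3ℚ} (0≤ι 3) β≤B+1)) 3Bτ≤ε)
        λ n N≤n → near n (ℕ.m⊔n≤o⇒n≤o N₀ N₂ N≤n) , gap n (ℕ.m⊔n≤o⇒m≤o N₀ N₂ N≤n)

-- The growth rate of the block weights

0<^ : ∀ {p} → 0ℚ ℚ.< p → ∀ n → 0ℚ ℚ.< p ^ n
0<^ 0<p zero    = 0<1
0<^ 0<p (suc n) = 0<* 0<p (0<^ 0<p n)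

^-inverse : ∀ {p q} → p ℚ.* q ≡ 1ℚ → ∀ n → p ^ n ℚ.* q ^ n ≡ 1ℚ
^-inverse pq≡1 zero = refl
^-inverse {p} {q} pq≡1 (suc n) = trans
  (solve 4 (λ p q s t → (p :* s) :* (q :* t) := (p :* q) :* (s :* t)) refl p q (p ^ n) (q ^ n))
  (trans (cong₂ ℚ._*_ pq≡1 (^-inverse pq≡1 n)) (ℚ.*-identityˡ 1ℚ))

bernoulli : ∀ {h} → 0ℚ ℚ.≤ h → ∀ n → 1ℚ ℚ.+ ι n ℚ.* h ℚ.≤ (1ℚ ℚ.+ h) ^ n
bernoulli {h} 0≤h zero = ℚ.≤-reflexive (trans (cong (1ℚ ℚ.+_) (ℚ.*-zeroˡ h)) (ℚ.+-identityʳ 1ℚ))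
bernoulli {h} 0≤h (suc n) = begin
  1ℚ ℚ.+ ι (suc n) ℚ.* h
    ≡⟨ cong (λ z → 1ℚ ℚ.+ z ℚ.* h) (+-/1 n) ⟩
  1ℚ ℚ.+ (ι n ℚ.+ 1ℚ) ℚ.* h
    ≤⟨ ≤-by (h ℚ.* (ι n ℚ.* h)) (0≤* 0≤h (0≤* (0≤ι n) 0≤h))
         (solve 2 (λ n h → (con 1ℚ :+ (n :+ con 1ℚ) :* h) :+ h :* (n :* h)
                        := (con 1ℚ :+ h) :* (con 1ℚ :+ n :* h)) refl (ι n) h) ⟩
  (1ℚ ℚ.+ h) ℚ.* (1ℚ ℚ.+ ι n ℚ.* h)
    ≤⟨ *-monoʳ (0≤+ 0≤1 0≤h) (bernoulli 0≤h n) ⟩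
  (1ℚ ℚ.+ h) ℚ.* (1ℚ ℚ.+ h) ^ n ∎
  where open ℚ.≤-Reasoning

archimedean-* : ∀ p {c} → 0ℚ ℚ.< c → ∃ λ N → ∀ n → N ℕ.≤ n → p ℚ.≤ ι n ℚ.* c
archimedean-* p {c} 0<c =
  let N , p/c≤N = archimedean (recip c ℚ.* p)
  in N , λ n N≤n → subst (ℚ._≤ ι n ℚ.* c)
    (trans (solve 3 (λ r p c → (r :* p) :* c := (r :* c) :* p) refl (recip c) p c)
      (trans (cong (ℚ._* p) (recip-inverse c 0<c)) (ℚ.*-identityˡ p)))
    (*-monoˡ (ℚ.<⇒≤ 0<c) (ℚ.≤-trans p/c≤N (/1-mono N≤n)))

pow-unbounded : ∀ c {h} → 0ℚ ℚ.< h → ∃ λ N → ∀ n → N ℕ.≤ n → c ℚ.< (1ℚ ℚ.+ h) ^ n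
pow-unbounded c {h} 0<h = let N , c≤nh = archimedean-* c 0<h in
  N , λ n N≤n → ℚ.<-≤-trans
    (ℚ.≤-<-trans (c≤nh n N≤n) (<-by 1ℚ 0<1 (ℚ.+-comm (ι n ℚ.* h) 1ℚ)))
    (bernoulli (ℚ.<⇒≤ 0<h) n)

crossing : ∀ (f : ℕ → ℚ) c m j → f m ℚ.≤ c → c ℚ.< f (j ℕ.+ m) →
  ∃ λ i → m ℕ.≤ i × f i ℚ.≤ c × c ℚ.< f (suc i)
crossing f c m zero    fm≤c c<fm = contradiction (ℚ.<-≤-trans c<fm fm≤c) (ℚ.<-irrefl refl)
crossing f c m (suc j) fm≤c c<f  = cases (f (j ℕ.+ m) ℚ.≤? c)
  where
  cases : Dec (f (j ℕ.+ m) ℚ.≤ c) → ∃ λ i → m ℕ.≤ i × f i ℚ.≤ c × c ℚ.< f (suc i)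
  cases (yes f≤c) = j ℕ.+ m , ℕ.m≤n+m m j , f≤c , c<f
  cases (no f≰c)  = crossing f c m j fm≤c (ℚ.≰⇒> f≰c)

-- Block j of the instance has elements of weight (1 + h)ʲ, and q = 1 / (1 + h).
-- D is about the number of blocks in which the weight grows by the factor β, so
-- that θ = β qᴰ is slightly below 1.  The left-hand side of balance is β times the sum
-- over d of h (qᵈ - qᴰ)⁺.  For h → 0 it tends to β - 1 - log β, and this is below
-- 1 exactly when exp (β - 2) < β.
record Rate (β : ℚ) : Set where
  field
    h q     : ℚ
    D       : ℕ
    0≤β     : 0ℚ ℚ.≤ β
    0<h     : 0ℚ ℚ.< h
    0<q     : 0ℚ ℚ.< q
    inverse : q ℚ.* (1ℚ ℚ.+ h) ≡ 1ℚ
    θ<1     : β ℚ.* q ^ D ℚ.< 1ℚ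
    balance : β ℚ.* (1ℚ ℚ.+ h) ℚ.- (1ℚ ℚ.+ h ℚ.+ ι D ℚ.* h) ℚ.* (β ℚ.* q ^ D) ℚ.< 1ℚ

-- With D = i + 1 the least exponent at which (1 + h)ᴰ exceeds β, minimality gives
-- θ ≥ q, and D h ≥ y + h then yields the balance.
rate-at-crossing : ∀ {β h y} D₀ i → 0ℚ ℚ.< h → 0ℚ ℚ.≤ β → D₀ ℕ.≤ i → ι D₀ ℚ.* h ≡ y →
  β ℚ.* ((1ℚ ℚ.+ h) ℚ.* (1ℚ ℚ.+ h)) ℚ.≤ y ℚ.+ (+ 2 / 1) →
  (1ℚ ℚ.+ h) ^ i ℚ.≤ β → β ℚ.< (1ℚ ℚ.+ h) ^ suc i → Rate β
rate-at-crossing {β} {h} {y} D₀ i 0<h 0≤β D₀≤i D₀h≡y gap λⁱ≤β β<λˢⁱ = record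
  { h = h ; q = q ; D = suc i ; 0≤β = 0≤β ; 0<h = 0<h ; 0<q = 0<q ; inverse = qΛ≡1
  ; θ<1 = θ<1 ; balance = balance }
  where
  open ℚ.≤-Reasoning
  Λ q θ : ℚ
  Λ = 1ℚ ℚ.+ h
  q = recip Λ
  θ = β ℚ.* q ^ suc i

  0<Λ : 0ℚ ℚ.< Λ
  0<Λ = 0<+ 0<1 0<h
  0≤Λ = ℚ.<⇒≤ 0<Λ

  qΛ≡1 : q ℚ.* Λ ≡ 1ℚ
  qΛ≡1 = recip-inverse Λ 0<Λ

  0<q : 0ℚ ℚ.< q
  0<q = ℚ.*-cancelʳ-<-nonNeg Λ {{ℚ.nonNegative 0≤Λ}}
    (subst₂ ℚ._<_ (sym (ℚ.*-zeroˡ Λ)) (sym qΛ≡1) 0<1)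

  q^Λ^≡1 : ∀ n → q ^ n ℚ.* Λ ^ n ≡ 1ℚ
  q^Λ^≡1 = ^-inverse qΛ≡1

  θ<1 : θ ℚ.< 1ℚ
  θ<1 = subst (θ ℚ.<_) (trans (ℚ.*-comm (Λ ^ suc i) (q ^ suc i)) (q^Λ^≡1 (suc i)))
    (ℚ.*-monoˡ-<-pos (q ^ suc i) {{ℚ.positive (0<^ 0<q (suc i))}} β<λˢⁱ)

  q≤θ : q ℚ.≤ θ
  q≤θ = begin
    q                          ≡⟨ ℚ.*-identityʳ q ⟨
    q ℚ.* 1ℚ                   ≡⟨ cong (q ℚ.*_) (q^Λ^≡1 i) ⟨
    q ℚ.* (q ^ i ℚ.* Λ ^ i)    ≡⟨ solve 3 (λ a b c → a :* (b :* c) := c :* (a :* b)) refl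
            q (q ^ i) (Λ ^ i) ⟩
    Λ ^ i ℚ.* q ^ suc i        ≤⟨ *-monoˡ (ℚ.<⇒≤ (0<^ 0<q (suc i))) λⁱ≤β ⟩
    θ                          ∎

  y+h≤Dh : y ℚ.+ h ℚ.≤ ι (suc i) ℚ.* h
  y+h≤Dh = begin
    y ℚ.+ h              ≡⟨ cong (ℚ._+ h) D₀h≡y ⟨
    ι D₀ ℚ.* h ℚ.+ h     ≡⟨ solve 2 (λ d h → d :* h :+ h := (d :+ con 1ℚ) :* h) refl (ι D₀) h ⟩
    (ι D₀ ℚ.+ 1ℚ) ℚ.* h  ≡⟨ cong (ℚ._* h) (+-/1 D₀) ⟨
    ι (suc D₀) ℚ.* h     ≤⟨ *-monoˡ (ℚ.<⇒≤ 0<h) (/1-mono (ℕ.s≤s D₀≤i)) ⟩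
    ι (suc i) ℚ.* h      ∎

  0≤y : 0ℚ ℚ.≤ y
  0≤y = subst (0ℚ ℚ.≤_) D₀h≡y (0≤* (0≤ι D₀) (ℚ.<⇒≤ 0<h))

  scaled : (β ℚ.* Λ ℚ.- (Λ ℚ.+ (y ℚ.+ h)) ℚ.* q) ℚ.* Λ ℚ.< 1ℚ ℚ.* Λ
  scaled = begin-strict
    (β ℚ.* Λ ℚ.- (Λ ℚ.+ (y ℚ.+ h)) ℚ.* q) ℚ.* Λ
      ≡⟨ solve 4 (λ b l y q → (b :* l :- y :* q) :* l := b :* (l :* l) :- y :* (q :* l)) refl
              β Λ (Λ ℚ.+ (y ℚ.+ h)) q ⟩
    β ℚ.* (Λ ℚ.* Λ) ℚ.- (Λ ℚ.+ (y ℚ.+ h)) ℚ.* (q ℚ.* Λ)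
      ≤⟨ ℚ.+-monoˡ-≤ (ℚ.- ((Λ ℚ.+ (y ℚ.+ h)) ℚ.* (q ℚ.* Λ))) gap ⟩
    (y ℚ.+ (+ 2 / 1)) ℚ.- (Λ ℚ.+ (y ℚ.+ h)) ℚ.* (q ℚ.* Λ)
      ≡⟨ cong (λ z → (y ℚ.+ (+ 2 / 1)) ℚ.- (Λ ℚ.+ (y ℚ.+ h)) ℚ.* z) qΛ≡1 ⟩
    (y ℚ.+ (+ 2 / 1)) ℚ.- (Λ ℚ.+ (y ℚ.+ h)) ℚ.* 1ℚ
      <⟨ <-by (h ℚ.+ h ℚ.+ h) (0<+ (0<+ 0<h 0<h) 0<h)
          (solve 2 (λ y h → ((y :+ con (+ 2 / 1)) :- (con 1ℚ :+ h :+ (y :+ h)) :* con 1ℚ) :+ (h :+ h :+ h)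
                         := con 1ℚ :* (con 1ℚ :+ h)) refl y h) ⟩
    1ℚ ℚ.* Λ ∎

  balance : β ℚ.* Λ ℚ.- (Λ ℚ.+ ι (suc i) ℚ.* h) ℚ.* θ ℚ.< 1ℚ
  balance = begin-strict
    β ℚ.* Λ ℚ.- (Λ ℚ.+ ι (suc i) ℚ.* h) ℚ.* θ
      ≤⟨ ℚ.+-monoʳ-≤ (β ℚ.* Λ) (ℚ.neg-antimono-≤ (ℚ.≤-trans
           (*-monoʳ (0≤+ 0≤Λ (0≤+ 0≤y (ℚ.<⇒≤ 0<h))) q≤θ)
           (*-monoˡ (0≤* 0≤β (ℚ.<⇒≤ (0<^ 0<q (suc i)))) (ℚ.+-monoʳ-≤ Λ y+h≤Dh)))) ⟩
    β ℚ.* Λ ℚ.- (Λ ℚ.+ (y ℚ.+ h)) ℚ.* q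
      <⟨ ℚ.*-cancelʳ-<-nonNeg Λ {{ℚ.nonNegative 0≤Λ}} scaled ⟩
    1ℚ ∎

-- Take h = y / D₀ with D₀ large.  Since (1 + h) ^ D₀ ≤ expSum y D₀ ≤ β, the powers
-- of 1 + h cross β only after D₀ steps.
rate : ∀ β y → 0ℚ ℚ.< y → β ℚ.< y ℚ.+ (+ 2 / 1) → expSum y eventually≤ β → Rate β
rate β y 0<y β<y+2 (M , expSum≤β) =
  let i , D₀≤i , λⁱ≤β , β<λˢⁱ = crossing (Λ ^_) β D₀ N λᴰ≤β (N-large (N ℕ.+ D₀) (ℕ.m≤m+n N D₀))
  in rate-at-crossing D₀ i 0<h (ℚ.<⇒≤ 0<β) D₀≤i D₀h≡y gap λⁱ≤β β<λˢⁱ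
  where
  open ℚ.≤-Reasoning
  τ = y ℚ.+ (+ 2 / 1) ℚ.- β
  0<τ : 0ℚ ℚ.< τ
  0<τ = 0<- β<y+2

  0<β : 0ℚ ℚ.< β
  0<β = ℚ.<-≤-trans 0<1 (ℚ.≤-trans
    (ℚ.≤-trans (ℚ.≤-reflexive (sym (expSum-0 M))) (expSum-mono ℚ.≤-refl (ℚ.<⇒≤ 0<y) M))
    (expSum≤β M ℕ.≤-refl))

  large₁ : ∃ λ N → ∀ n → N ℕ.≤ n → y ℚ.≤ ι n ℚ.* 1ℚ
  large₁ = archimedean-* y 0<1
  large₂ : ∃ λ N → ∀ n → N ℕ.≤ n → 3ℚ ℚ.* β ℚ.* y ℚ.≤ ι n ℚ.* τ
  large₂ = archimedean-* (3ℚ ℚ.* β ℚ.* y) 0<τ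

  N₁ = proj₁ large₁
  N₂ = proj₁ large₂
  D₀ = suc (M ⊔ (N₁ ⊔ N₂))

  M≤D₀ : M ℕ.≤ D₀
  M≤D₀ = ℕ.m≤n⇒m≤1+n (ℕ.m≤m⊔n M (N₁ ⊔ N₂))
  N₁₂≤D₀ : N₁ ⊔ N₂ ℕ.≤ D₀
  N₁₂≤D₀ = ℕ.m≤n⇒m≤1+n (ℕ.m≤n⊔m M (N₁ ⊔ N₂))

  h Λ : ℚ
  h = y ℚ.* (+ 1 / D₀)
  Λ = 1ℚ ℚ.+ h

  D₀h≡y : ι D₀ ℚ.* h ≡ y
  D₀h≡y = trans (solve 3 (λ d y r → d :* (y :* r) := y :* (d :* r)) refl (ι D₀) y (+ 1 / D₀))
    (trans (cong (y ℚ.*_) (*-/suc (M ⊔ (N₁ ⊔ N₂)))) (ℚ.*-identityʳ y))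

  0<D₀ : 0ℚ ℚ.< ι D₀
  0<D₀ = 0<ι (M ⊔ (N₁ ⊔ N₂))

  0<h : 0ℚ ℚ.< h
  0<h = ℚ.*-cancelˡ-<-nonNeg (ι D₀) {{ℚ.nonNegative (ℚ.<⇒≤ 0<D₀)}}
    (subst₂ ℚ._<_ (sym (ℚ.*-zeroʳ (ι D₀))) (sym D₀h≡y) 0<y)
  0≤h = ℚ.<⇒≤ 0<h

  h≤1 : h ℚ.≤ 1ℚ
  h≤1 = cancel-pos 0<D₀ (subst (ℚ._≤ ι D₀ ℚ.* 1ℚ) (sym D₀h≡y)
    (proj₂ large₁ D₀ (ℕ.m⊔n≤o⇒m≤o N₁ N₂ N₁₂≤D₀)))

  3βh≤τ : 3ℚ ℚ.* β ℚ.* h ℚ.≤ τ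
  3βh≤τ = cancel-pos 0<D₀ (subst (ℚ._≤ ι D₀ ℚ.* τ)
    (trans (cong (3ℚ ℚ.* β ℚ.*_) (sym D₀h≡y))
      (solve 3 (λ b d h → b :* (d :* h) := d :* (b :* h)) refl (3ℚ ℚ.* β) (ι D₀) h))
    (proj₂ large₂ D₀ (ℕ.m⊔n≤o⇒n≤o N₁ N₂ N₁₂≤D₀)))

  gap : β ℚ.* (Λ ℚ.* Λ) ℚ.≤ y ℚ.+ (+ 2 / 1)
  gap = begin
    β ℚ.* (Λ ℚ.* Λ)
      ≤⟨ ≤-by (β ℚ.* (h ℚ.* (1ℚ ℚ.- h))) (0≤* (ℚ.<⇒≤ 0<β) (0≤* 0≤h (0≤- h≤1)))
          (solve 2 (λ b h → b :* ((con 1ℚ :+ h) :* (con 1ℚ :+ h)) :+ b :* (h :* (con 1ℚ :- h))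
                         := b :+ con 3ℚ :* b :* h) refl β h) ⟩
    β ℚ.+ 3ℚ ℚ.* β ℚ.* h
      ≤⟨ ℚ.+-monoʳ-≤ β 3βh≤τ ⟩
    β ℚ.+ τ
      ≡⟨ solve 2 (λ b y → b :+ (y :- b) := y) refl β (y ℚ.+ (+ 2 / 1)) ⟩
    y ℚ.+ (+ 2 / 1) ∎

  λᴰ≤β : Λ ^ D₀ ℚ.≤ β
  λᴰ≤β = ℚ.≤-trans (pow≤expSum 0≤h D₀)
    (subst (λ z → expSum z D₀ ℚ.≤ β) (sym D₀h≡y) (expSum≤β D₀ M≤D₀))

  unbounded = pow-unbounded β 0<h
  N = proj₁ unbounded
  N-large : ∀ n → N ℕ.≤ n → β ℚ.< Λ ^ n
  N-large = proj₂ unbounded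

-- Sums and the potential

∑ : ℕ → (ℕ → ℚ) → ℚ
∑ zero    x = 0ℚ
∑ (suc n) x = x n ℚ.+ ∑ n x

∑-mono : ∀ n {x y} → (∀ i → i ℕ.< n → x i ℚ.≤ y i) → ∑ n x ℚ.≤ ∑ n y
∑-mono zero    x≤y = ℚ.≤-refl
∑-mono (suc n) {x} {y} x≤y = ℚ.+-mono-≤ {x n} {y n} {∑ n x} {∑ n y} (x≤y n ℕ.≤-refl)
  (∑-mono n λ i i<n → x≤y i (ℕ.m≤n⇒m≤1+n i<n))

∑-cong : ∀ n {x y} → (∀ i → i ℕ.< n → x i ≡ y i) → ∑ n x ≡ ∑ n y
∑-cong zero    x≡y = refl
∑-cong (suc n) x≡y = cong₂ ℚ._+_ (x≡y n ℕ.≤-refl) (∑-cong n λ i i<n → x≡y i (ℕ.m≤n⇒m≤1+n i<n))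

∑-head : ∀ n x → ∑ (suc n) x ≡ x 0 ℚ.+ ∑ n (x ∘ suc)
∑-head zero    x = refl
∑-head (suc n) x = trans (cong (x (suc n) ℚ.+_) (∑-head n x))
  (solve 3 (λ a b c → a :+ (b :+ c) := b :+ (a :+ c)) refl (x (suc n)) (x 0) (∑ n (x ∘ suc)))

∑-* : ∀ c n x → ∑ n (λ i → c ℚ.* x i) ≡ c ℚ.* ∑ n x
∑-* c zero    x = sym (ℚ.*-zeroʳ c)
∑-* c (suc n) x = trans (cong (c ℚ.* x n ℚ.+_) (∑-* c n x)) (sym (ℚ.*-distribˡ-+ c (x n) (∑ n x)))

∑-+ : ∀ n x y → ∑ n (λ i → x i ℚ.+ y i) ≡ ∑ n x ℚ.+ ∑ n y
∑-+ zero    x y = refl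
∑-+ (suc n) x y = trans (cong (x n ℚ.+ y n ℚ.+_) (∑-+ n x y))
  (solve 4 (λ a b c d → (a :+ b) :+ (c :+ d) := (a :+ c) :+ (b :+ d)) refl (x n) (y n) (∑ n x) (∑ n y))

0≤∑ : ∀ n {x} → (∀ i → 0ℚ ℚ.≤ x i) → 0ℚ ℚ.≤ ∑ n x
0≤∑ zero    0≤x = ℚ.≤-refl
0≤∑ (suc n) 0≤x = 0≤+ (0≤x n) (0≤∑ n 0≤x)

∑-prefix : ∀ {j} n {x} → (∀ i → 0ℚ ℚ.≤ x i) → j ℕ.≤ n → ∑ j x ℚ.≤ ∑ n x
∑-prefix n {x} 0≤x j≤n = go (ℕ.≤⇒≤′ j≤n)
  where
  go : ∀ {j n} → j ℕ.≤′ n → ∑ j x ℚ.≤ ∑ n x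
  go ℕ.≤′-refl                = ℚ.≤-refl
  go (ℕ.≤′-step {n} j≤n) = ℚ.≤-trans (go j≤n) (≤-by (x n) (0≤x n) (ℚ.+-comm (∑ n x) (x n)))

∑-zero : ∀ n {x} → (∀ i → i ℕ.< n → x i ≡ 0ℚ) → ∑ n x ≡ 0ℚ
∑-zero zero    x≡0 = refl
∑-zero (suc n) x≡0 = cong₂ ℚ._+_ (x≡0 n ℕ.≤-refl) (∑-zero n λ i i<n → x≡0 i (ℕ.m≤n⇒m≤1+n i<n))

∑-truncate : ∀ {j} n {x} → j ℕ.≤ n → (∀ i → j ℕ.≤ i → x i ≡ 0ℚ) → ∑ n x ≡ ∑ j x
∑-truncate {j} n {x} j≤n x≡0 = go (ℕ.≤⇒≤′ j≤n)
  where
  go : ∀ {n} → j ℕ.≤′ n → ∑ n x ≡ ∑ j x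
  go ℕ.≤′-refl           = refl
  go (ℕ.≤′-step {n} j≤n) = trans (cong₂ ℚ._+_ (x≡0 n (ℕ.≤′⇒≤ j≤n)) (go j≤n)) (ℚ.+-identityˡ (∑ j x))

∑-single : ∀ n j {x} → (∀ i → i ≢ j → x i ≡ 0ℚ) → x j ℚ.≤ 1ℚ → ∑ n x ℚ.≤ 1ℚ
∑-single zero    j x≡0 xj≤1 = 0≤1
∑-single (suc n) j {x} x≡0 xj≤1 = cases (n ℕ.≟ j)
  where
  cases : Dec (n ≡ j) → x n ℚ.+ ∑ n x ℚ.≤ 1ℚ
  cases (yes refl) = ℚ.≤-trans
    (ℚ.≤-reflexive (trans (cong (x n ℚ.+_) (∑-zero n λ i i<n → x≡0 i (ℕ.<⇒≢ i<n))) (ℚ.+-identityʳ (x n)))) xj≤1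
  cases (no n≢j) = ℚ.≤-trans
    (ℚ.≤-reflexive (trans (cong (ℚ._+ ∑ n x) (x≡0 n n≢j)) (ℚ.+-identityˡ (∑ n x)))) (∑-single n j x≡0 xj≤1)

-- The sum of φ (n - 1 - i) x i over i < n: the profile φ is applied to the ages of
-- the entries, the latest entry having age 0.
dot : (ℕ → ℚ) → ℕ → (ℕ → ℚ) → ℚ
dot φ zero    x = 0ℚ
dot φ (suc n) x = φ 0 ℚ.* x n ℚ.+ dot (φ ∘ suc) n x

dot-cong : ∀ φ n {x y} → (∀ i → i ℕ.< n → x i ≡ y i) → dot φ n x ≡ dot φ n y
dot-cong φ zero    x≡y = refl
dot-cong φ (suc n) x≡y = cong₂ ℚ._+_ (cong (φ 0 ℚ.*_) (x≡y n ℕ.≤-refl))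
  (dot-cong (φ ∘ suc) n λ i i<n → x≡y i (ℕ.m≤n⇒m≤1+n i<n))

dot-monoˡ : ∀ {φ χ} n {x} → (∀ i → 0ℚ ℚ.≤ x i) → (∀ d → φ d ℚ.≤ χ d) → dot φ n x ℚ.≤ dot χ n x
dot-monoˡ zero    0≤x φ≤χ = ℚ.≤-refl
dot-monoˡ {φ} {χ} (suc n) {x} 0≤x φ≤χ =
  ℚ.+-mono-≤ {φ 0 ℚ.* x n} {χ 0 ℚ.* x n} {dot (φ ∘ suc) n x} {dot (χ ∘ suc) n x}
    (*-monoˡ (0≤x n) (φ≤χ 0)) (dot-monoˡ n 0≤x (φ≤χ ∘ suc))

dot-monoʳ : ∀ {φ} n {x y} → (∀ d → 0ℚ ℚ.≤ φ d) → (∀ i → x i ℚ.≤ y i) → dot φ n x ℚ.≤ dot φ n y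
dot-monoʳ zero    0≤φ x≤y = ℚ.≤-refl
dot-monoʳ {φ} (suc n) {x} {y} 0≤φ x≤y =
  ℚ.+-mono-≤ {φ 0 ℚ.* x n} {φ 0 ℚ.* y n} {dot (φ ∘ suc) n x} {dot (φ ∘ suc) n y}
    (*-monoʳ (0≤φ 0) (x≤y n)) (dot-monoʳ n (0≤φ ∘ suc) x≤y)

dot-const-+ : ∀ c φ n x → dot (λ d → c ℚ.+ φ d) n x ≡ c ℚ.* ∑ n x ℚ.+ dot φ n x
dot-const-+ c φ zero    x = solve 1 (λ c → con 0ℚ := c :* con 0ℚ :+ con 0ℚ) refl c
dot-const-+ c φ (suc n) x = trans (cong ((c ℚ.+ φ 0) ℚ.* x n ℚ.+_) (dot-const-+ c (φ ∘ suc) n x))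
  (solve 5 (λ c f x s d → (c :+ f) :* x :+ (c :* s :+ d) := c :* (x :+ s) :+ (f :* x :+ d)) refl
    c (φ 0) (x n) (∑ n x) (dot (φ ∘ suc) n x))

dot-* : ∀ c φ n x → dot (λ d → c ℚ.* φ d) n x ≡ c ℚ.* dot φ n x
dot-* c φ zero    x = sym (ℚ.*-zeroʳ c)
dot-* c φ (suc n) x = trans (cong ((c ℚ.* φ 0) ℚ.* x n ℚ.+_) (dot-* c (φ ∘ suc) n x))
  (solve 4 (λ c f x d → (c :* f) :* x :+ c :* d := c :* (f :* x :+ d)) refl
    c (φ 0) (x n) (dot (φ ∘ suc) n x))

dot-linear : ∀ {φ χ ω ζ} a b → (∀ d → φ d ≡ χ d ℚ.+ a ℚ.* ω d ℚ.- b ℚ.* ζ d) → ∀ n x →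
  dot φ n x ≡ dot χ n x ℚ.+ a ℚ.* dot ω n x ℚ.- b ℚ.* dot ζ n x
dot-linear a b φ≡ zero x = solve 2 (λ a b → con 0ℚ := con 0ℚ :+ a :* con 0ℚ :- b :* con 0ℚ) refl a b
dot-linear {φ} {χ} {ω} {ζ} a b φ≡ (suc n) x =
  trans (cong₂ (λ s t → s ℚ.* x n ℚ.+ t) (φ≡ 0) (dot-linear a b (φ≡ ∘ suc) n x))
  (solve 9 (λ c a w b z x C W Z →
      (c :+ a :* w :- b :* z) :* x :+ (C :+ a :* W :- b :* Z)
      := (c :* x :+ C) :+ a :* (w :* x :+ W) :- b :* (z :* x :+ Z)) refl
    (χ 0) a (ω 0) b (ζ 0) (x n) (dot (χ ∘ suc) n x) (dot (ω ∘ suc) n x) (dot (ζ ∘ suc) n x))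

-- Only the R latest entries can contribute a positive amount.
dot-bounded : ∀ φ R n {x K} → (∀ d → φ d ℚ.≤ 1ℚ) → (∀ d → R ℕ.≤ d → φ d ℚ.≤ 0ℚ) →
  (∀ i → 0ℚ ℚ.≤ x i) → (∀ i → x i ℚ.≤ K) → dot φ n x ℚ.≤ ι R ℚ.* K
dot-bounded φ R zero {x} {K} φ≤1 φ≤0 0≤x x≤K =
  0≤* (0≤ι R) (ℚ.≤-trans (0≤x 0) (x≤K 0))
dot-bounded φ zero (suc n) {x} {K} φ≤1 φ≤0 0≤x x≤K =
  subst (φ 0 ℚ.* x n ℚ.+ dot (φ ∘ suc) n x ℚ.≤_) (ℚ.+-identityˡ (ι 0 ℚ.* K))
    (ℚ.+-mono-≤ {φ 0 ℚ.* x n} {0ℚ} {dot (φ ∘ suc) n x} {ι 0 ℚ.* K}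
      (ℚ.≤-trans (*-monoˡ (0≤x n) (φ≤0 0 ℕ.z≤n)) (ℚ.≤-reflexive (ℚ.*-zeroˡ (x n))))
      (dot-bounded (φ ∘ suc) zero n (φ≤1 ∘ suc) (λ d _ → φ≤0 (suc d) ℕ.z≤n) 0≤x x≤K))
dot-bounded φ (suc R) (suc n) {x} {K} φ≤1 φ≤0 0≤x x≤K =
  subst (φ 0 ℚ.* x n ℚ.+ dot (φ ∘ suc) n x ℚ.≤_)
    (trans (solve 2 (λ r k → con 1ℚ :* k :+ r :* k := (r :+ con 1ℚ) :* k) refl (ι R) K)
      (cong (ℚ._* K) (sym (+-/1 R))))
    (ℚ.+-mono-≤ {φ 0 ℚ.* x n} {1ℚ ℚ.* K} {dot (φ ∘ suc) n x} {ι R ℚ.* K}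
      (ℚ.≤-trans (*-monoˡ (0≤x n) (φ≤1 0)) (*-monoʳ 0≤1 (x≤K n)))
      (dot-bounded (φ ∘ suc) R n (φ≤1 ∘ suc) (λ d R≤d → φ≤0 (suc d) (ℕ.s≤s R≤d)) 0≤x x≤K))

module Potential {β : ℚ} (rate : Rate β) where
  open Rate rate

  Λ θ : ℚ
  Λ = 1ℚ ℚ.+ h
  θ = β ℚ.* q ^ D

  0≤h = ℚ.<⇒≤ 0<h
  0≤q = ℚ.<⇒≤ 0<q
  0≤Λ : 0ℚ ℚ.≤ Λ
  0≤Λ = 0≤+ 0≤1 0≤h

  0≤q^ : ∀ n → 0ℚ ℚ.≤ q ^ n
  0≤q^ n = ℚ.<⇒≤ (0<^ 0<q n)

  q≤1 : q ℚ.≤ 1ℚ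
  q≤1 = ≤-by (q ℚ.* h) (0≤* 0≤q 0≤h)
    (trans (solve 2 (λ q h → q :+ q :* h := q :* (con 1ℚ :+ h)) refl q h) inverse)

  q^≤1 : ∀ n → q ^ n ℚ.≤ 1ℚ
  q^≤1 zero    = ℚ.≤-refl
  q^≤1 (suc n) = ℚ.≤-trans (*-monoˡ (0≤q^ n) q≤1)
    (ℚ.≤-trans (ℚ.≤-reflexive (ℚ.*-identityˡ (q ^ n))) (q^≤1 n))

  -- The positive part of qᵈ - qᴰ, written so that the geometric self-similarity is
  -- definitional.
  excess : ℕ → ℕ → ℚ
  excess zero    d       = 0ℚ
  excess (suc D) zero    = 1ℚ ℚ.- q ^ suc D
  excess (suc D) (suc d) = q ℚ.* excess D d

  0≤excess : ∀ D d → 0ℚ ℚ.≤ excess D d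
  0≤excess zero    d       = ℚ.≤-refl
  0≤excess (suc D) zero    = 0≤- (q^≤1 (suc D))
  0≤excess (suc D) (suc d) = 0≤* 0≤q (0≤excess D d)

  -- Dual feasibility: of the value qᵈ of an element of age d, the amount qᴰ is
  -- charged to its place in the solution and the rest to its having been covered.
  q^≤excess : ∀ D d → q ^ d ℚ.≤ q ^ D ℚ.+ excess D d
  q^≤excess zero    d       = q^≤1 d
  q^≤excess (suc D) zero    = ℚ.≤-reflexive
    (solve 1 (λ x → con 1ℚ := x :+ (con 1ℚ :- x)) refl (q ^ suc D))
  q^≤excess (suc D) (suc d) = subst (q ^ suc d ℚ.≤_)
    (ℚ.*-distribˡ-+ q (q ^ D) (excess D d)) (*-monoʳ 0≤q (q^≤excess D d))

  -- The closed form of h times the sum of all values of excess D.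
  excess-total : ℕ → ℚ
  excess-total D = Λ ℚ.- (Λ ℚ.+ ι D ℚ.* h) ℚ.* q ^ D

  excess-total-zero : excess-total 0 ≡ 0ℚ
  excess-total-zero = solve 1 (λ h → (con 1ℚ :+ h) :- ((con 1ℚ :+ h) :+ con 0ℚ :* h) :* con 1ℚ := con 0ℚ) refl h

  excess-total-suc : ∀ D → h ℚ.* (1ℚ ℚ.- q ^ suc D) ℚ.+ q ℚ.* excess-total D ≡ excess-total (suc D)
  excess-total-suc D = trans
    (solve 4 (λ h q x d → h :* (con 1ℚ :- q :* x) :+ q :* (con 1ℚ :+ h :- (con 1ℚ :+ h :+ d :* h) :* x)
       := (h :+ q :* (con 1ℚ :+ h)) :- (con 1ℚ :+ h :+ (d :+ con 1ℚ) :* h) :* (q :* x)) refl h q (q ^ D) (ι D))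
    (cong₂ (λ a b → a ℚ.- (Λ ℚ.+ b ℚ.* h) ℚ.* q ^ suc D)
      (trans (cong (h ℚ.+_) inverse) (ℚ.+-comm h 1ℚ)) (sym (+-/1 D)))

  0≤excess-total : ∀ D → 0ℚ ℚ.≤ excess-total D
  0≤excess-total zero    = ℚ.≤-reflexive (sym excess-total-zero)
  0≤excess-total (suc D) = subst (0ℚ ℚ.≤_) (excess-total-suc D)
    (0≤+ (0≤* 0≤h (0≤excess (suc D) zero)) (0≤* 0≤q (0≤excess-total D)))

  ∑-excess : ∀ D n → h ℚ.* ∑ n (excess D) ℚ.≤ excess-total D
  ∑-excess D zero = subst (ℚ._≤ excess-total D) (sym (ℚ.*-zeroʳ h)) (0≤excess-total D)
  ∑-excess zero (suc n) = subst₂ ℚ._≤_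
    (cong (h ℚ.*_) (sym (ℚ.+-identityˡ (∑ n (excess 0))))) refl (∑-excess zero n)
  ∑-excess (suc D) (suc n) = begin
    h ℚ.* ∑ (suc n) (excess (suc D))
      ≡⟨ cong (h ℚ.*_) (trans (∑-head n (excess (suc D))) (cong (1ℚ ℚ.- q ^ suc D ℚ.+_) (∑-* q n (excess D)))) ⟩
    h ℚ.* (1ℚ ℚ.- q ^ suc D ℚ.+ q ℚ.* ∑ n (excess D))
      ≡⟨ solve 4 (λ h a q s → h :* (a :+ q :* s) := h :* a :+ q :* (h :* s)) refl
              h (1ℚ ℚ.- q ^ suc D) q (∑ n (excess D)) ⟩
    h ℚ.* (1ℚ ℚ.- q ^ suc D) ℚ.+ q ℚ.* (h ℚ.* ∑ n (excess D))
      ≤⟨ ℚ.+-monoʳ-≤ (h ℚ.* (1ℚ ℚ.- q ^ suc D)) (*-monoʳ 0≤q (∑-excess D n)) ⟩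
    h ℚ.* (1ℚ ℚ.- q ^ suc D) ℚ.+ q ℚ.* excess-total D
      ≡⟨ excess-total-suc D ⟩
    excess-total (suc D) ∎
    where open ℚ.≤-Reasoning

  -- Up to age d, a point that was once covered has contributed β h times its excess
  -- to the bound on the solutions in each block, and h times its discounted weight
  -- to the optimum in each later block.  The profile is the first total minus the
  -- second, which amounts to 1 - qᵈ.
  Φ : ℕ → ℚ
  Φ d = β ℚ.* (h ℚ.* ∑ (suc d) (excess D)) ℚ.+ (q ^ d ℚ.- 1ℚ)

  Φ-suc : ∀ d → Φ (suc d) ≡ Φ d ℚ.+ (β ℚ.* h) ℚ.* excess D (suc d) ℚ.- h ℚ.* q ^ suc d
  Φ-suc d = trans
    (solve 6 (λ b h e s q x → b :* (h :* (e :+ s)) :+ (q :* x :- con 1ℚ)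
       := b :* (h :* s) :+ ((q :* (con 1ℚ :+ h)) :* x :- con 1ℚ) :+ (b :* h) :* e :- h :* (q :* x)) refl
      β h (excess D (suc d)) (∑ (suc d) (excess D)) q (q ^ d))
    (cong (λ z → β ℚ.* (h ℚ.* ∑ (suc d) (excess D)) ℚ.+ (z ℚ.- 1ℚ)
                 ℚ.+ (β ℚ.* h) ℚ.* excess D (suc d) ℚ.- h ℚ.* q ^ suc d)
      (trans (cong (ℚ._* q ^ d) inverse) (ℚ.*-identityˡ (q ^ d))))

  σ : ℚ
  σ = 1ℚ ℚ.- (β ℚ.* Λ ℚ.- (Λ ℚ.+ ι D ℚ.* h) ℚ.* θ)

  0<σ : 0ℚ ℚ.< σ
  0<σ = 0<- balance

  Φ≤ : ∀ d → Φ d ℚ.≤ q ^ d ℚ.- σ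
  Φ≤ d = begin
    β ℚ.* (h ℚ.* ∑ (suc d) (excess D)) ℚ.+ (q ^ d ℚ.- 1ℚ)
      ≤⟨ ℚ.+-monoˡ-≤ (q ^ d ℚ.- 1ℚ) (*-monoʳ 0≤β (∑-excess D (suc d))) ⟩
    β ℚ.* excess-total D ℚ.+ (q ^ d ℚ.- 1ℚ)
      ≡⟨ solve 5 (λ b l t x y → b :* (l :- (l :+ t) :* x) :+ (y :- con 1ℚ)
                  := y :- (con 1ℚ :- (b :* l :- (l :+ t) :* (b :* x)))) refl β Λ (ι D ℚ.* h) (q ^ D) (q ^ d) ⟩
    q ^ d ℚ.- σ ∎
    where open ℚ.≤-Reasoning

  Φ≤1 : ∀ d → Φ d ℚ.≤ 1ℚ
  Φ≤1 d = ℚ.≤-trans (Φ≤ d) (ℚ.≤-trans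
    (≤-by σ (ℚ.<⇒≤ 0<σ) (solve 2 (λ x s → (x :- s) :+ s := x) refl (q ^ d) σ)) (q^≤1 d))

  -- Old elements have a non-positive profile, since Φ d ≤ qᵈ - σ with σ > 0 the slack
  -- in the balance.
  cutoff : ∃ λ R → ∀ d → R ℕ.≤ d → Φ d ℚ.≤ 0ℚ
  cutoff = R , λ d R≤d → ℚ.≤-trans (Φ≤ d) (subst (q ^ d ℚ.- σ ℚ.≤_) (ℚ.+-inverseʳ σ)
      (ℚ.+-monoˡ-≤ (ℚ.- σ) (begin
        q ^ d
          ≡⟨ ℚ.*-identityʳ (q ^ d) ⟨
        q ^ d ℚ.* 1ℚ
          ≡⟨ cong (q ^ d ℚ.*_) (recip-inverse σ 0<σ) ⟨
        q ^ d ℚ.* (recip σ ℚ.* σ)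
          ≤⟨ *-monoʳ (0≤q^ d) (*-monoˡ (ℚ.<⇒≤ 0<σ) (ℚ.<⇒≤ (large d R≤d))) ⟩
        q ^ d ℚ.* (Λ ^ d ℚ.* σ)
          ≡⟨ ℚ.*-assoc (q ^ d) (Λ ^ d) σ ⟨
        (q ^ d ℚ.* Λ ^ d) ℚ.* σ
          ≡⟨ cong (ℚ._* σ) (^-inverse inverse d) ⟩
        1ℚ ℚ.* σ
          ≡⟨ ℚ.*-identityˡ σ ⟩
        σ ∎)))
    where
    open ℚ.≤-Reasoning
    R = proj₁ (pow-unbounded (recip σ) 0<h)
    large = proj₂ (pow-unbounded (recip σ) 0<h)

  -- Dividing by (1 + h)ⁿ turns the weights (1 + h)ⁱ into discounts by age.
  ∑-discount : ∀ n x → ∑ n (λ i → Λ ^ i ℚ.* x i) ℚ.* q ^ n ≡ dot (λ d → q ^ suc d) n x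
  ∑-discount zero    x = refl
  ∑-discount (suc n) x = begin
    (Λ ^ n ℚ.* x n ℚ.+ S) ℚ.* (q ℚ.* q ^ n)
      ≡⟨ solve 5 (λ l x s q p → (l :* x :+ s) :* (q :* p) := q :* ((p :* l) :* x) :+ q :* (s :* p)) refl
          (Λ ^ n) (x n) S q (q ^ n) ⟩
    q ℚ.* ((q ^ n ℚ.* Λ ^ n) ℚ.* x n) ℚ.+ q ℚ.* (S ℚ.* q ^ n)
      ≡⟨ cong₂ (λ a b → q ℚ.* (a ℚ.* x n) ℚ.+ q ℚ.* b) (^-inverse inverse n) (∑-discount n x) ⟩
    q ℚ.* (1ℚ ℚ.* x n) ℚ.+ q ℚ.* dot (λ d → q ^ suc d) n x
      ≡⟨ cong₂ ℚ._+_ (sym (ℚ.*-assoc q 1ℚ (x n))) (sym (dot-* q (λ d → q ^ suc d) n x)) ⟩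
    dot (λ d → q ^ suc d) (suc n) x ∎
    where
    open ≡-Reasoning
    S = ∑ n (λ i → Λ ^ i ℚ.* x i)

  growth : ℚ → ℚ → ℚ
  growth κ k = h ℚ.* (κ ℚ.- θ ℚ.* k)

  -- Here m i counts the points of block i that the solution covered at the end of
  -- some block, and y i those covered at the end of block n.  Bounding the
  -- discounted value of y by the capacity k at price qᴰ per place, and by m for the
  -- excess over that price, turns the competitive ratio in block n into an increase
  -- of the potential.
  potential-step : ∀ n {κ k m y} →
    (∀ i → 0ℚ ℚ.≤ y i) → (∀ i → y i ℚ.≤ m i) → ∑ (suc n) y ℚ.≤ k →
    ∑ n (λ i → Λ ^ i ℚ.* m i) ℚ.+ Λ ^ n ℚ.* κ ℚ.≤ β ℚ.* ∑ (suc n) (λ i → Λ ^ i ℚ.* y i) →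
    dot Φ n m ℚ.+ growth κ k ℚ.≤ dot Φ (suc n) m
  potential-step n {κ} {k} {m} {y} 0≤y y≤m size ratio = begin
    dot Φ n m ℚ.+ h ℚ.* (κ ℚ.- θ ℚ.* k)
      ≤⟨ ℚ.+-monoʳ-≤ (dot Φ n m) (*-monoʳ 0≤h main) ⟩
    dot Φ n m ℚ.+ h ℚ.* (β ℚ.* (excess D 0 ℚ.* m n ℚ.+ X) ℚ.- G)
      ≡⟨ solve 7 (λ F h b e x X G → F :+ h :* (b :* (e :* x :+ X) :- G)
                  := (b :* (h :* (e :+ con 0ℚ)) :+ (con 1ℚ :- con 1ℚ)) :* x :+ (F :+ (b :* h) :* X :- h :* G)) refl
          (dot Φ n m) h β (excess D 0) (m n) X G ⟩
    Φ 0 ℚ.* m n ℚ.+ (dot Φ n m ℚ.+ (β ℚ.* h) ℚ.* X ℚ.- h ℚ.* G)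
      ≡⟨ cong (Φ 0 ℚ.* m n ℚ.+_) (dot-linear (β ℚ.* h) h Φ-suc n m) ⟨
    dot Φ (suc n) m ∎
    where
    open ℚ.≤-Reasoning
    X = dot (excess D ∘ suc) n m
    G = dot (λ d → q ^ suc d) n m
    S = ∑ n (λ i → Λ ^ i ℚ.* m i)

    value-bound : dot (q ^_) (suc n) y ℚ.≤ q ^ D ℚ.* k ℚ.+ dot (excess D) (suc n) m
    value-bound = begin
      dot (q ^_) (suc n) y
        ≤⟨ dot-monoˡ (suc n) 0≤y (q^≤excess D) ⟩
      dot (λ d → q ^ D ℚ.+ excess D d) (suc n) y
        ≡⟨ dot-const-+ (q ^ D) (excess D) (suc n) y ⟩
      q ^ D ℚ.* ∑ (suc n) y ℚ.+ dot (excess D) (suc n) y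
        ≤⟨ ℚ.+-mono-≤ {q ^ D ℚ.* ∑ (suc n) y} {q ^ D ℚ.* k} {dot (excess D) (suc n) y} {dot (excess D) (suc n) m}
             (*-monoʳ (0≤q^ D) size) (dot-monoʳ (suc n) (0≤excess D) y≤m) ⟩
      q ^ D ℚ.* k ℚ.+ dot (excess D) (suc n) m ∎

    discounted : G ℚ.+ κ ℚ.≤ β ℚ.* dot (q ^_) (suc n) y
    discounted = begin
      G ℚ.+ κ
        ≡⟨ cong₂ ℚ._+_ (∑-discount n m) (ℚ.*-identityˡ κ) ⟨
      S ℚ.* q ^ n ℚ.+ 1ℚ ℚ.* κ
        ≡⟨ cong (λ z → S ℚ.* q ^ n ℚ.+ z ℚ.* κ) (^-inverse inverse n) ⟨
      S ℚ.* q ^ n ℚ.+ (q ^ n ℚ.* Λ ^ n) ℚ.* κ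
        ≡⟨ solve 4 (λ s p l c → s :* p :+ (p :* l) :* c := (s :+ l :* c) :* p) refl S (q ^ n) (Λ ^ n) κ ⟩
      (S ℚ.+ Λ ^ n ℚ.* κ) ℚ.* q ^ n
        ≤⟨ *-monoˡ (0≤q^ n) ratio ⟩
      (β ℚ.* (Λ ^ n ℚ.* y n ℚ.+ T)) ℚ.* q ^ n
        ≡⟨ solve 5 (λ b l y t p → (b :* (l :* y :+ t)) :* p
                := b :* ((p :* l) :* y :+ t :* p)) refl β (Λ ^ n) (y n) T (q ^ n) ⟩
      β ℚ.* ((q ^ n ℚ.* Λ ^ n) ℚ.* y n ℚ.+ T ℚ.* q ^ n)
        ≡⟨ cong₂ (λ a b → β ℚ.* (a ℚ.* y n ℚ.+ b)) (^-inverse inverse n) (∑-discount n y) ⟩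
      β ℚ.* dot (q ^_) (suc n) y ∎
      where T = ∑ n (λ i → Λ ^ i ℚ.* y i)

    main : κ ℚ.- θ ℚ.* k ℚ.≤ β ℚ.* dot (excess D) (suc n) m ℚ.- G
    main = begin
      κ ℚ.- θ ℚ.* k
        ≡⟨ solve 3 (λ g c t → c :- t := (g :+ c) :- g :- t) refl G κ (θ ℚ.* k) ⟩
      (G ℚ.+ κ) ℚ.- G ℚ.- θ ℚ.* k
        ≤⟨ ℚ.+-monoˡ-≤ (ℚ.- (θ ℚ.* k)) (ℚ.+-monoˡ-≤ (ℚ.- G)
             (ℚ.≤-trans discounted (*-monoʳ 0≤β value-bound))) ⟩
      β ℚ.* (q ^ D ℚ.* k ℚ.+ dot (excess D) (suc n) m) ℚ.- G ℚ.- θ ℚ.* k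
        ≡⟨ solve 5 (λ b x k e g → b :* (x :* k :+ e) :- g :- (b :* x) :* k := b :* e :- g) refl
                β (q ^ D) k (dot (excess D) (suc n) m) G ⟩
      β ℚ.* dot (excess D) (suc n) m ℚ.- G ∎

  outgrow : ∀ {r k N} → 0ℚ ℚ.≤ k → r ℚ.+ 1ℚ ℚ.≤ N ℚ.* (h ℚ.* (1ℚ ℚ.- θ)) →
    N ℚ.* (h ℚ.* (θ ℚ.* N)) ℚ.+ 1ℚ ℚ.≤ k → r ℚ.* k ℚ.< N ℚ.* growth k (k ℚ.+ N)
  outgrow {r} {k} {N} 0≤k r+1≤ c+1≤k = begin-strict
    r ℚ.* k
      <⟨ <-by 1ℚ 0<1 refl ⟩
    r ℚ.* k ℚ.+ 1ℚ
      ≡⟨ solve 2 (λ a c → a :+ con 1ℚ := a :+ (c :+ con 1ℚ) :- c) refl (r ℚ.* k) c ⟩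
    r ℚ.* k ℚ.+ (c ℚ.+ 1ℚ) ℚ.- c
      ≤⟨ ℚ.+-monoˡ-≤ (ℚ.- c) (ℚ.+-monoʳ-≤ (r ℚ.* k) c+1≤k) ⟩
    r ℚ.* k ℚ.+ k ℚ.- c
      ≡⟨ cong (ℚ._- c) (solve 2 (λ r k → r :* k :+ k := (r :+ con 1ℚ) :* k) refl r k) ⟩
    (r ℚ.+ 1ℚ) ℚ.* k ℚ.- c
      ≤⟨ ℚ.+-monoˡ-≤ (ℚ.- c) (*-monoˡ 0≤k r+1≤) ⟩
    (N ℚ.* (h ℚ.* (1ℚ ℚ.- θ))) ℚ.* k ℚ.- c
      ≡⟨ solve 4 (λ n h t k → (n :* (h :* (con 1ℚ :- t))) :* k :- n :* (h :* (t :* n))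
                   := n :* (h :* (k :- t :* (k :+ n)))) refl N h θ k ⟩
    N ℚ.* growth k (k ℚ.+ N) ∎
    where
    open ℚ.≤-Reasoning
    c = N ℚ.* (h ℚ.* (θ ℚ.* N))

  -- Over n blocks the potential grows by about n h (1 - θ) κ, while it never exceeds
  -- R κ.  Both n and κ are chosen in terms of R; κ dominates the n places by which
  -- the capacity κ + n exceeds κ.
  potential-overflow : ∃ λ n → ∃ λ κ → 1 ℕ.≤ κ × ∀ m →
    (∀ i → 0ℚ ℚ.≤ m i) → (∀ i → m i ℚ.≤ ι κ) →
    ¬ (ι n ℚ.* growth (ι κ) (ι κ ℚ.+ ι n) ℚ.≤ dot Φ n m)
  potential-overflow = n , κ , ℕ.s≤s ℕ.z≤n , λ m 0≤m m≤κ grown → ℚ.<-irrefl refl (begin-strict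
    ι R ℚ.* ι κ
      <⟨ outgrow {ι R} {ι κ} {ι n} (0≤ι κ) R+1≤ κ-large ⟩
    ι n ℚ.* growth (ι κ) (ι κ ℚ.+ ι n)
      ≤⟨ grown ⟩
    dot Φ n m
      ≤⟨ dot-bounded Φ R n Φ≤1 (proj₂ cutoff) 0≤m m≤κ ⟩
    ι R ℚ.* ι κ ∎)
    where
    open ℚ.≤-Reasoning
    R = proj₁ cutoff

    0<1-θ : 0ℚ ℚ.< 1ℚ ℚ.- θ
    0<1-θ = 0<- θ<1

    many = archimedean-* (ι R ℚ.+ 1ℚ) (0<* 0<h 0<1-θ)
    n = proj₁ many
    R+1≤ : ι R ℚ.+ 1ℚ ℚ.≤ ι n ℚ.* (h ℚ.* (1ℚ ℚ.- θ))
    R+1≤ = proj₂ many n ℕ.≤-refl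

    wide = archimedean (ι n ℚ.* (h ℚ.* (θ ℚ.* ι n)) ℚ.+ 1ℚ)
    κ = suc (proj₁ wide)

    κ-large : ι n ℚ.* (h ℚ.* (θ ℚ.* ι n)) ℚ.+ 1ℚ ℚ.≤ ι κ
    κ-large = ℚ.≤-trans (proj₂ wide) (/1-mono (ℕ.n≤1+n (proj₁ wide)))

-- Coverage objectives

∪-∩-count : ∀ {n} (p q : Subset n) → ∣ p ∪ q ∣ ℕ.+ ∣ p ∩ q ∣ ≡ ∣ p ∣ ℕ.+ ∣ q ∣
∪-∩-count [] [] = refl
∪-∩-count (inside  ∷ p) (inside  ∷ q) = cong suc (trans (ℕ.+-suc _ _)
  (trans (cong suc (∪-∩-count p q)) (sym (ℕ.+-suc _ _))))
∪-∩-count (inside  ∷ p) (outside ∷ q) = cong suc (∪-∩-count p q)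
∪-∩-count (outside ∷ p) (inside  ∷ q) = trans (cong suc (∪-∩-count p q)) (sym (ℕ.+-suc _ _))
∪-∩-count (outside ∷ p) (outside ∷ q) = ∪-∩-count p q

⋃ : ∀ {m κ} → (Fin m → Subset κ) → Subset m → Subset κ
⋃ c []            = ⊥
⋃ c (inside  ∷ X) = c zero ∪ ⋃ (c ∘ suc) X
⋃ c (outside ∷ X) = ⋃ (c ∘ suc) X

∈⋃⁺ : ∀ {m κ} (c : Fin m → Subset κ) {X u x} → u ∈ X → x ∈ c u → x ∈ ⋃ c X
∈⋃⁺ c {inside  ∷ X} here        x∈c = x∈p∪q⁺ (inj₁ x∈c)
∈⋃⁺ c {inside  ∷ X} (there u∈X) x∈c = x∈p∪q⁺ {p = c zero} (inj₂ (∈⋃⁺ (c ∘ suc) u∈X x∈c))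
∈⋃⁺ c {outside ∷ X} (there u∈X) x∈c = ∈⋃⁺ (c ∘ suc) u∈X x∈c

∈⋃⁻ : ∀ {m κ} (c : Fin m → Subset κ) {X x} → x ∈ ⋃ c X → ∃ λ u → u ∈ X × x ∈ c u
∈⋃⁻ c {[]} x∈ = contradiction x∈ ∉⊥
∈⋃⁻ c {inside ∷ X} x∈ with x∈p∪q⁻ (c zero) (⋃ (c ∘ suc) X) x∈
... | inj₁ x∈c = zero , here , x∈c
... | inj₂ x∈⋃ = let u , u∈X , x∈c = ∈⋃⁻ (c ∘ suc) x∈⋃ in suc u , there u∈X , x∈c
∈⋃⁻ c {outside ∷ X} x∈ = let u , u∈X , x∈c = ∈⋃⁻ (c ∘ suc) x∈ in suc u , there u∈X , x∈c

⋃-mono : ∀ {m κ} (c : Fin m → Subset κ) {X Y} → X ⊆ Y → ⋃ c X ⊆ ⋃ c Y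
⋃-mono c X⊆Y x∈ = let u , u∈X , x∈c = ∈⋃⁻ c x∈ in ∈⋃⁺ c (X⊆Y u∈X) x∈c

⋃-∪ : ∀ {m κ} (c : Fin m → Subset κ) X Y → ⋃ c (X ∪ Y) ≡ ⋃ c X ∪ ⋃ c Y
⋃-∪ c X Y = ⊆-antisym forth back
  where
  forth : ⋃ c (X ∪ Y) ⊆ ⋃ c X ∪ ⋃ c Y
  forth x∈ with ∈⋃⁻ c x∈
  ... | u , u∈X∪Y , x∈c with x∈p∪q⁻ X Y u∈X∪Y
  ...   | inj₁ u∈X = x∈p∪q⁺ (inj₁ (∈⋃⁺ c u∈X x∈c))
  ...   | inj₂ u∈Y = x∈p∪q⁺ {p = ⋃ c X} (inj₂ (∈⋃⁺ c u∈Y x∈c))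

  back : ⋃ c X ∪ ⋃ c Y ⊆ ⋃ c (X ∪ Y)
  back x∈ with x∈p∪q⁻ (⋃ c X) (⋃ c Y) x∈
  ... | inj₁ x∈X = ⋃-mono c {X} {X ∪ Y} (λ u∈X → x∈p∪q⁺ {p = X} {Y} (inj₁ u∈X)) x∈X
  ... | inj₂ x∈Y = ⋃-mono c {Y} {X ∪ Y} (λ u∈Y → x∈p∪q⁺ {p = X} {Y} (inj₂ u∈Y)) x∈Y

⋃-∩ : ∀ {m κ} (c : Fin m → Subset κ) X Y → ⋃ c (X ∩ Y) ⊆ ⋃ c X ∩ ⋃ c Y
⋃-∩ c X Y x∈ = let u , u∈X∩Y , x∈c = ∈⋃⁻ c x∈ ; u∈X , u∈Y = x∈p∩q⁻ X Y u∈X∩Y in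
  x∈p∩q⁺ (∈⋃⁺ c u∈X x∈c , ∈⋃⁺ c u∈Y x∈c)

⋃-⊥ : ∀ {m κ} (c : Fin m → Subset κ) → ⋃ c ⊥ ≡ ⊥
⋃-⊥ {zero}  c = refl
⋃-⊥ {suc m} c = ⋃-⊥ (c ∘ suc)

⋃-⁅⁆ : ∀ {m κ} (c : Fin m → Subset κ) u → ⋃ c ⁅ u ⁆ ≡ c u
⋃-⁅⁆ c u = ⊆-antisym
  (λ x∈ → let v , v∈u , x∈c = ∈⋃⁻ c x∈ in subst (λ v → _ ∈ c v) (x∈⁅y⁆⇒x≡y u v∈u) x∈c)
  (∈⋃⁺ c (x∈⁅x⁆ u))

⋃-elements : ∀ {m t κ} (c : Fin m → Subset κ) (us : History m t) S →
  ⋃ c (elements us S) ≡ ⋃ (c ∘ lookup us) S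
⋃-elements c []       []            = ⋃-⊥ c
⋃-elements c (u ∷ us) (inside  ∷ S) =
  trans (⋃-∪ c ⁅ u ⁆ (elements us S)) (cong₂ _∪_ (⋃-⁅⁆ c u) (⋃-elements c us S))
⋃-elements c (u ∷ us) (outside ∷ S) = ⋃-elements c us S

-- If each chosen member covers at most one point in all rows together, the union
-- has no more points than there are chosen members.
⋃-size : ∀ {m κ} n (c : Fin m → ℕ → Subset κ) S →
  (∀ {p} → p ∈ S → ∑ n (λ i → ι ∣ c p i ∣) ℚ.≤ 1ℚ) →
  ∑ n (λ i → ι ∣ ⋃ (λ p → c p i) S ∣) ℚ.≤ ι ∣ S ∣
⋃-size {κ = κ} n c [] _ = ℚ.≤-reflexive (∑-zero n λ i _ → cong ι (∣⊥∣≡0 κ))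
⋃-size n c (outside ∷ S) small = ⋃-size n (c ∘ suc) S (small ∘ there)
⋃-size n c (inside ∷ S) small = begin
  ∑ n (λ i → ι ∣ c zero i ∪ ⋃ (λ p → c (suc p) i) S ∣)
    ≤⟨ ∑-mono n (λ i _ → /1-mono (∪-count (c zero i) (⋃ (λ p → c (suc p) i) S))) ⟩
  ∑ n (λ i → ι (∣ c zero i ∣ ℕ.+ ∣ ⋃ (λ p → c (suc p) i) S ∣))
    ≡⟨ ∑-cong n (λ i _ → ι-+ ∣ c zero i ∣ ∣ ⋃ (λ p → c (suc p) i) S ∣) ⟩
  ∑ n (λ i → ι ∣ c zero i ∣ ℚ.+ ι ∣ ⋃ (λ p → c (suc p) i) S ∣)
    ≡⟨ ∑-+ n (λ i → ι ∣ c zero i ∣) (λ i → ι ∣ ⋃ (λ p → c (suc p) i) S ∣) ⟩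
  ∑ n (λ i → ι ∣ c zero i ∣) ℚ.+ ∑ n (λ i → ι ∣ ⋃ (λ p → c (suc p) i) S ∣)
    ≤⟨ ℚ.+-mono-≤ {∑ n (λ i → ι ∣ c zero i ∣)} {1ℚ}
         {∑ n (λ i → ι ∣ ⋃ (λ p → c (suc p) i) S ∣)} {ι ∣ S ∣}
         (small here) (⋃-size n (c ∘ suc) S (small ∘ there)) ⟩
  1ℚ ℚ.+ ι ∣ S ∣
    ≡⟨ trans (ℚ.+-comm 1ℚ (ι ∣ S ∣)) (sym (+-/1 ∣ S ∣)) ⟩
  ι (suc ∣ S ∣) ∎
  where
  open ℚ.≤-Reasoning
  ∪-count : ∀ {n} (p q : Subset n) → ∣ p ∪ q ∣ ℕ.≤ ∣ p ∣ ℕ.+ ∣ q ∣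
  ∪-count p q = subst (∣ p ∪ q ∣ ℕ.≤_) (∪-∩-count p q) (ℕ.m≤m+n ∣ p ∪ q ∣ ∣ p ∩ q ∣)

≤-slack : ∀ {p q} → p ℚ.≤ q → ∀ ε → 0ℚ ℚ.< ε → ∃ λ N → ∀ n → N ℕ.≤ n → p ℚ.≤ q ℚ.+ ε
≤-slack p≤q ε 0<ε = 0 , λ _ _ → ℚ.≤-trans p≤q (≤-by ε (ℚ.<⇒≤ 0<ε) refl)

module Coverage {m κ : ℕ} (n : ℕ) (w : ℕ → ℚ) (0≤w : ∀ i → 0ℚ ℚ.≤ w i)
                (c : Fin m → ℕ → Subset κ) where

  weight : (ℕ → Subset κ) → ℚ
  weight B = ∑ n (λ i → w i ℚ.* ι ∣ B i ∣)

  weight-mono : ∀ {B C} → (∀ i → B i ⊆ C i) → weight B ℚ.≤ weight C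
  weight-mono B⊆C = ∑-mono n λ i _ → *-monoʳ (0≤w i) (/1-mono (p⊆q⇒∣p∣≤∣q∣ (B⊆C i)))

  covered : Subset m → ℕ → Subset κ
  covered X i = ⋃ (λ u → c u i) X

  coverage : Objective m
  coverage = record
    { f           = λ X → fromℚ (weight (covered X))
    ; nonNegative = λ X → ≤-slack (0≤∑ n λ i → 0≤* (0≤w i) (0≤ι ∣ covered X i ∣))
    ; monotone    = λ X Y X⊆Y → ≤-slack (weight-mono λ i → ⋃-mono (λ u → c u i) X⊆Y)
    ; submodular  = λ X Y → ≤-slack (submodular X Y)
    }
    where
    submodular : ∀ X Y → weight (covered (X ∪ Y)) ℚ.+ weight (covered (X ∩ Y)) ℚ.≤
                         weight (covered X) ℚ.+ weight (covered Y)
    submodular X Y = subst₂ ℚ._≤_ (∑-+ n (term (X ∪ Y)) (term (X ∩ Y))) (∑-+ n (term X) (term Y))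
      (∑-mono n λ i _ → row i)
      where
      term : Subset m → ℕ → ℚ
      term Z i = w i ℚ.* ι ∣ covered Z i ∣

      row : ∀ i → w i ℚ.* ι ∣ covered (X ∪ Y) i ∣ ℚ.+ w i ℚ.* ι ∣ covered (X ∩ Y) i ∣ ℚ.≤
                  w i ℚ.* ι ∣ covered X i ∣ ℚ.+ w i ℚ.* ι ∣ covered Y i ∣
      row i = subst₂ ℚ._≤_
        (factor ∣ covered (X ∪ Y) i ∣ ∣ covered (X ∩ Y) i ∣) (factor ∣ covered X i ∣ ∣ covered Y i ∣)
        (*-monoʳ (0≤w i) (/1-mono (begin
        ∣ covered (X ∪ Y) i ∣ ℕ.+ ∣ covered (X ∩ Y) i ∣
          ≤⟨ ℕ.+-mono-≤ (ℕ.≤-reflexive (cong ∣_∣ (⋃-∪ cᵢ X Y))) (p⊆q⇒∣p∣≤∣q∣ (⋃-∩ cᵢ X Y)) ⟩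
        ∣ covered X i ∪ covered Y i ∣ ℕ.+ ∣ covered X i ∩ covered Y i ∣
          ≡⟨ ∪-∩-count (covered X i) (covered Y i) ⟩
        ∣ covered X i ∣ ℕ.+ ∣ covered Y i ∣ ∎)))
        where
        open ℕ.≤-Reasoning
        cᵢ = λ u → c u i
        factor : ∀ a b → w i ℚ.* ι (a ℕ.+ b) ≡ w i ℚ.* ι a ℚ.+ w i ℚ.* ι b
        factor a b = trans (cong (w i ℚ.*_) (ι-+ a b)) (ℚ.*-distribˡ-+ (w i) (ι a) (ι b))

  reach : ∀ {t} → History m t → Subset t → ℕ → Subset κ
  reach us S i = ⋃ (λ p → c (lookup us p) i) S

  oracle-weight : ∀ {t} (us : History m t) S → weight (covered (elements us S)) ≡ weight (reach us S)
  oracle-weight us S = ∑-cong n λ i _ →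
    cong (λ B → w i ℚ.* ι ∣ B ∣) (⋃-elements (λ u → c u i) us S)

-- Optimal sets, ratios and encodings

-- The competitive ratio refers to an optimal set, so one has to be exhibited.
maximiser : ∀ t k (F : Subset t → ℚ) →
  ∃ λ T → ∣ T ∣ ℕ.≤ k × (∀ T′ → ∣ T′ ∣ ℕ.≤ k → F T′ ℚ.≤ F T)
maximiser zero k F = [] , ℕ.z≤n , λ { [] _ → ℚ.≤-refl }
maximiser (suc t) zero F =
  let T , ∣T∣≤0 , best = maximiser t zero (F ∘ (outside ∷_))
  in outside ∷ T , ∣T∣≤0 , λ { (outside ∷ T′) → best T′ ; (inside ∷ T′) () }
maximiser (suc t) (suc k) F =
  compare (maximiser t (suc k) (F ∘ (outside ∷_))) (maximiser t k (F ∘ (inside ∷_)))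
  where
  compare :
    (∃ λ T → ∣ T ∣ ℕ.≤ suc k × (∀ T′ → ∣ T′ ∣ ℕ.≤ suc k → F (outside ∷ T′) ℚ.≤ F (outside ∷ T))) →
    (∃ λ T → ∣ T ∣ ℕ.≤ k × (∀ T′ → ∣ T′ ∣ ℕ.≤ k → F (inside ∷ T′) ℚ.≤ F (inside ∷ T))) →
    ∃ λ T → ∣ T ∣ ℕ.≤ suc k × (∀ T′ → ∣ T′ ∣ ℕ.≤ suc k → F T′ ℚ.≤ F T)
  compare (O , ∣O∣≤ , O-best) (T , ∣T∣≤ , T-best) with ℚ.≤-total (F (outside ∷ O)) (F (inside ∷ T))
  ... | inj₁ O≤T = inside ∷ T , ℕ.s≤s ∣T∣≤ , λ
    { (outside ∷ T′) T′≤       → ℚ.≤-trans (O-best T′ T′≤) O≤T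
    ; (inside  ∷ T′) (ℕ.s≤s T′≤) → T-best T′ T′≤ }
  ... | inj₂ T≤O = outside ∷ O , ∣O∣≤ , λ
    { (outside ∷ T′) T′≤       → O-best T′ T′≤
    ; (inside  ∷ T′) (ℕ.s≤s T′≤) → ℚ.≤-trans (T-best T′ T′≤) T≤O }

≤-limit : ∀ {p q} → (∀ ε → 0ℚ ℚ.< ε → p ℚ.≤ q ℚ.+ ε) → p ℚ.≤ q
≤-limit {p} {q} p≤q+ε = cases (p ℚ.≤? q)
  where
  cases : Dec (p ℚ.≤ q) → p ℚ.≤ q
  cases (yes p≤q) = p≤q
  cases (no p≰q)  =
    let r , q<r , r<p = ℚ.<-dense (ℚ.≰⇒> p≰q)
        p≤r = subst (p ℚ.≤_) (solve 2 (λ q r → q :+ (r :- q) := r) refl q r) (p≤q+ε (r ℚ.- q) (0<- q<r))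
    in contradiction (ℚ.<-≤-trans r<p p≤r) (ℚ.<-irrefl refl)

fromℚ-cancel-< : ∀ {p q} → fromℚ p < fromℚ q → p ℚ.< q
fromℚ-cancel-< (ε , 0<ε , N , p+ε≤q) = ℚ.<-≤-trans (<-by ε 0<ε refl) (p+ε≤q N ℕ.≤-refl)

-- The reciprocal of α is eventually at least that of β, so a real inequality with
-- the factor 1 / α becomes a rational one.
ratio-bound : ∀ α (1≤α : 1ℝ ≤ α) {β x y} → seq α eventually≤ β → 0ℚ ℚ.≤ x →
  α ⁻¹⟨ 1≤⇒0< {α} 1≤α ⟩ * fromℚ x ≤ fromℚ y → x ℚ.≤ β ℚ.* y
ratio-bound α 1≤α {β} {x} {y} (M , a≤β) 0≤x x/α≤y = begin
  x                       ≡⟨ ℚ.*-identityˡ x ⟨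
  1ℚ ℚ.* x                ≡⟨ cong (ℚ._* x) (recip-inverse β 0<β) ⟨
  (recip β ℚ.* β) ℚ.* x   ≡⟨ solve 3 (λ r b x → (r :* b) :* x := b :* (r :* x)) refl (recip β) β x ⟩
  β ℚ.* (recip β ℚ.* x)   ≤⟨ *-monoʳ (ℚ.<⇒≤ 0<β) (≤-limit within) ⟩
  β ℚ.* y                 ∎
  where
  open ℚ.≤-Reasoning
  pos = 1≤⇒0< {α} 1≤α
  N = proj₁ (proj₂ (proj₂ pos))

  0<a : ∀ n → N ℕ.≤ n → 0ℚ ℚ.< seq α n
  0<a n N≤n = ℚ.<-≤-trans (ℚ.positive⁻¹ (0ℚ ℚ.+ ℚ.½)) (proj₂ (proj₂ (proj₂ pos)) n N≤n)

  0<β : 0ℚ ℚ.< β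
  0<β = ℚ.<-≤-trans (0<a (N ⊔ M) (ℕ.m≤m⊔n N M)) (a≤β (N ⊔ M) (ℕ.m≤n⊔m N M))

  within : ∀ ε → 0ℚ ℚ.< ε → recip β ℚ.* x ℚ.≤ y ℚ.+ ε
  within ε 0<ε =
    let K , near = x/α≤y ε 0<ε
        n   = (N ⊔ M) ⊔ K
        NM≤n = ℕ.m≤m⊔n (N ⊔ M) K
        N≤n = ℕ.m⊔n≤o⇒m≤o N M NM≤n
        M≤n = ℕ.m⊔n≤o⇒n≤o N M NM≤n
    in ℚ.≤-trans (*-monoˡ 0≤x (recip-anti (0<a n N≤n) (a≤β n M≤n))) (near n (ℕ.m≤n⊔m (N ⊔ M) K))

-- A type of labels represented faithfully by numbers below size; decoding may
-- identify numbers, so only one of the two round trips is required.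
record Encoding (A : Set) : Set where
  field
    size          : ℕ
    encode        : A → Fin size
    decode        : Fin size → A
    decode-encode : ∀ a → decode (encode a) ≡ a

open Encoding

fin-encoding : ∀ n → Encoding (Fin n)
fin-encoding n = record { size = n ; encode = λ i → i ; decode = λ i → i ; decode-encode = λ _ → refl }

bool-encoding : Encoding Bool
bool-encoding = record
  { size          = 2
  ; encode        = λ { false → zero ; true → suc zero }
  ; decode        = λ { zero → false ; (suc _) → true }
  ; decode-encode = λ { false → refl ; true → refl }
  }

infixr 2 _×-encoding_
_×-encoding_ : ∀ {A B} → Encoding A → Encoding B → Encoding (A × B)
a ×-encoding b = record
  { size          = size a ℕ.* size b
  ; encode        = λ (x , y) → combine (encode a x) (encode b y)
  ; decode        = λ i → Product.map (decode a) (decode b) (remQuot (size b) i)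
  ; decode-encode = λ (x , y) →
      trans (cong (Product.map (decode a) (decode b)) (remQuot-combine (encode a x) (encode b y)))
            (cong₂ _,_ (decode-encode a x) (decode-encode b y))
  }

vec-encoding : ∀ {A} → Encoding A → ∀ n → Encoding (Vec A n)
vec-encoding a zero = record
  { size = 1 ; encode = λ _ → zero ; decode = λ _ → [] ; decode-encode = λ { [] → refl } }
vec-encoding a (suc n) = record
  { size          = size p
  ; encode        = λ { (x ∷ xs) → encode p (x , xs) }
  ; decode        = λ i → let x , xs = decode p i in x ∷ xs
  ; decode-encode = λ { (x ∷ xs) → cong (λ (y , ys) → y ∷ ys) (decode-encode p (x , xs)) }
  }
  where p = a ×-encoding vec-encoding a n

-- The adversary

truncate : ∀ {κ} n → (ℕ → Subset κ) → Vec (Subset κ) n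
truncate zero    B = []
truncate (suc n) B = B 0 ∷ truncate n (B ∘ suc)

row : ∀ {n κ} → Vec (Subset κ) n → ℕ → Subset κ
row []       _       = ⊥
row (r ∷ rs) zero    = r
row (r ∷ rs) (suc i) = row rs i

row-truncate : ∀ {n κ} (B : ℕ → Subset κ) {i} → i ℕ.< n → row (truncate n B) i ≡ B i
row-truncate {suc n} B {zero}  _         = refl
row-truncate {suc n} B {suc i} (ℕ.s≤s i<n) = row-truncate (B ∘ suc) i<n

row-truncate-⊆ : ∀ n {κ} (B : ℕ → Subset κ) i → row (truncate n B) i ⊆ B i
row-truncate-⊆ zero    B i       = ⊥⊆
row-truncate-⊆ (suc n) B zero    = ⊆-refl
row-truncate-⊆ (suc n) B (suc i) = row-truncate-⊆ n (B ∘ suc) i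

⁅_⁆-if_ : ∀ {κ} {P : Set} → Fin κ → Dec P → Subset κ
⁅ x ⁆-if yes _ = ⁅ x ⁆
⁅ x ⁆-if no  _ = ⊥

-- Copy x of block j, as a family of subsets indexed by blocks.
point : ∀ {κ} → ℕ → Fin κ → ℕ → Subset κ
point j x i = ⁅ x ⁆-if (i ℕ.≟ j)

point-at : ∀ {κ} j (x : Fin κ) → point j x j ≡ ⁅ x ⁆
point-at j x = cases (j ℕ.≟ j)
  where
  cases : (d : Dec (j ≡ j)) → ⁅ x ⁆-if d ≡ ⁅ x ⁆
  cases (yes _)   = refl
  cases (no j≢j) = contradiction refl j≢j

point-off : ∀ {κ} j (x : Fin κ) {i} → i ≢ j → point j x i ≡ ⊥
point-off j x {i} i≢j = cases (i ℕ.≟ j)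
  where
  cases : (d : Dec (i ≡ j)) → ⁅ x ⁆-if d ≡ ⊥
  cases (yes i≡j) = contradiction i≡j i≢j
  cases (no _)    = refl

≡⊥ : ∀ {κ} {p q : Subset κ} → p ⊆ q → q ≡ ⊥ → p ≡ ⊥
≡⊥ p⊆q refl = ⊆-antisym p⊆q ⊥⊆

∪-lub : ∀ {κ} {p q r : Subset κ} → p ⊆ r → q ⊆ r → p ∪ q ⊆ r
∪-lub {p = p} {q} p⊆r q⊆r x∈ = [ p⊆r , q⊆r ]′ (x∈p∪q⁻ p q x∈)

module Game {β : ℚ} (rate : Rate β) (α : ℝ) (1≤α : 1ℝ ≤ α) (α≤β : seq α eventually≤ β)
  (n κ : ℕ) (A : OnlineAlgorithm (κ ℕ.+ n))
  (strict : StrictlyMonotone A) (ratio : HasCompetitiveRatio A (α ⁻¹⟨ 1≤⇒0< {α} 1≤α ⟩)) where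

  open Rate rate using (0<h)
  open Potential rate
  open Encoding

  k : ℕ
  k = κ ℕ.+ n

  -- The points to be covered form n rows of κ copies.  An element of Ω is labelled
  -- by the round in which it may arrive and by the set of points it covers.  With
  -- all such elements present from the start, the objective is fixed and only the
  -- sequence of arrivals depends on the algorithm; the round makes the arriving
  -- elements distinct.
  Label : Set
  Label = Fin (n ℕ.* suc κ) × Vec (Subset κ) n

  labels : Encoding Label
  labels = fin-encoding (n ℕ.* suc κ) ×-encoding vec-encoding (vec-encoding bool-encoding κ) n

  Ω : Set
  Ω = Fin (size labels)

  tag : Ω → ℕ
  tag u = toℕ (proj₁ (decode labels u))

  rows : Ω → ℕ → Subset κ
  rows u = row (proj₂ (decode labels u))

  element : ∀ {s} → s ℕ.< n ℕ.* suc κ → (ℕ → Subset κ) → Ω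
  element s<T B = encode labels (fromℕ< s<T , truncate n B)

  tag-element : ∀ {s} (s<T : s ℕ.< n ℕ.* suc κ) B → tag (element s<T B) ≡ s
  tag-element s<T B = trans (cong (toℕ ∘ proj₁) (decode-encode labels (fromℕ< s<T , truncate n B)))
    (toℕ-fromℕ< s<T)

  rows-element : ∀ {s} (s<T : s ℕ.< n ℕ.* suc κ) B i → rows (element s<T B) i ≡ row (truncate n B) i
  rows-element s<T B i = cong (λ l → row (proj₂ l) i) (decode-encode labels (fromℕ< s<T , truncate n B))

  open Coverage n (Λ ^_) (λ i → ℚ.<⇒≤ (0<^ (0<+ 0<1 0<h) i)) rows

  kept-solution : ∀ {t} → History (size labels) t → Subset t
  kept-solution = output A coverage

  keeps : ∀ {t} → Ω → History (size labels) t → Subset t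
  keeps u us = proj₁ (rule A (map toℕ (u ∷ us)) (oracle coverage (u ∷ us)) (kept-solution us))

  includes : ∀ {t} → Ω → History (size labels) t → Side
  includes u us = proj₂ (rule A (map toℕ (u ∷ us)) (oracle coverage (u ∷ us)) (kept-solution us))

  improves : ∀ {t} u (us : History (size labels) t) → Unique (u ∷ us) →
    head (kept-solution (u ∷ us)) ≡ inside →
    weight (reach us (kept-solution us)) ℚ.< weight (reach (u ∷ us) (kept-solution (u ∷ us)))
  improves u us unique included = subst₂ ℚ._<_
    (oracle-weight us (kept-solution us)) (oracle-weight (u ∷ us) (kept-solution (u ∷ us)))
    (fromℚ-cancel-< (strict coverage u us unique included))

  competitive : ∀ {t} (us : History (size labels) t) → Unique us → ∀ X → ∣ X ∣ ℕ.≤ k →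
    weight (reach us X) ℚ.≤ β ℚ.* weight (reach us (kept-solution us))
  competitive {t} us unique X ∣X∣≤k =
    let OPT , ∣OPT∣≤k , best = maximiser t k (λ Y → weight (covered (elements us Y)))
    in subst₂ ℚ._≤_ (oracle-weight us X) (cong (β ℚ.*_) (oracle-weight us (kept-solution us)))
      (ℚ.≤-trans (best X ∣X∣≤k)
        (ratio-bound α 1≤α α≤β
          (0≤∑ n λ i → 0≤* (ℚ.<⇒≤ (0<^ (0<+ 0<1 0<h) i)) (0≤ι ∣ covered (elements us OPT) i ∣))
          (ratio coverage us unique OPT (∣OPT∣≤k , λ Y ∣Y∣≤k → ≤-slack (best Y ∣Y∣≤k)))))

  reach-round : ∀ {t} u (us : History (size labels) t) side kept S i →
    reach (u ∷ us) (side ∷ (kept ∩ S)) i ⊆ rows u i ∪ reach us S i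
  reach-round u us inside  kept S i = ∪-lub (p⊆p∪q (reach us S i))
    (⊆-trans (⋃-mono (λ p → rows (lookup us p) i) (p∩q⊆q kept S)) (q⊆p∪q (rows u i) (reach us S i)))
  reach-round u us outside kept S i =
    ⊆-trans (⋃-mono (λ p → rows (lookup us p) i) (p∩q⊆q kept S)) (q⊆p∪q (rows u i) (reach us S i))

  -- An element that covers only what the solution covers already cannot raise the
  -- value, whatever is removed for it, so strict monotonicity forces its rejection.
  rejected : ∀ {t} u (us : History (size labels) t) → Unique (u ∷ us) →
    (∀ i → rows u i ⊆ reach us (kept-solution us) i) →
    ∃ λ kept → kept-solution (u ∷ us) ≡ outside ∷ (kept ∩ kept-solution us)
  rejected u us unique covered-already = cases (includes u us) (keeps u us) refl
    where
    S = kept-solution us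
    cases : ∀ side kept → kept-solution (u ∷ us) ≡ side ∷ (kept ∩ S) →
      ∃ λ kept → kept-solution (u ∷ us) ≡ outside ∷ (kept ∩ S)
    cases outside kept eq = kept , eq
    cases inside  kept eq = contradiction
      (ℚ.<-≤-trans (improves u us unique (cong head eq))
        (subst (λ Z → weight (reach (u ∷ us) Z) ℚ.≤ weight (reach us S)) (sym eq)
          (weight-mono λ i → ⊆-trans (reach-round u us inside kept S i)
            (∪-lub (covered-already i) ⊆-refl))))
      (ℚ.<-irrefl refl)

  -- Only copies are ever chosen, and each covers one point.
  Small : ∀ {t} → History (size labels) t → Subset t → Set
  Small us S = ∀ p → p ∈ S → ∑ n (λ i → ι ∣ rows (lookup us p) i ∣) ℚ.≤ 1ℚ

  small-round : ∀ {t} u {us : History (size labels) t} {S} → ∑ n (λ i → ι ∣ rows u i ∣) ℚ.≤ 1ℚ →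
    Small us S → ∀ side kept → Small (u ∷ us) (side ∷ (kept ∩ S))
  small-round u u≤1 small side kept zero    _          = u≤1
  small-round u u≤1 small side kept (suc p) (there p∈) = small p (p∩q⊆q kept _ p∈)

  unique-∷ : ∀ {t s} u (us : History (size labels) t) → tag u ≡ s →
    All (λ v → tag v ℕ.< s) us → Unique us → Unique (u ∷ us)
  unique-∷ u us refl tags unique = All.map (λ v<u u≡v → ℕ.<⇒≢ v<u (cong tag (sym u≡v))) tags ∷ unique

  round<T : ∀ {j c} → j ℕ.< n → c ℕ.≤ κ → j ℕ.* suc κ ℕ.+ c ℕ.< n ℕ.* suc κ
  round<T {j} {c} j<n c≤κ = ℕ.<-≤-trans
    (subst (j ℕ.* suc κ ℕ.+ c ℕ.<_) (ℕ.+-comm (j ℕ.* suc κ) (suc κ)) (ℕ.+-monoʳ-< (j ℕ.* suc κ) (ℕ.s≤s c≤κ)))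
    (ℕ.*-monoˡ-≤ (suc κ) j<n)

  -- The game after j blocks.  X consists of the summaries of these blocks, so that
  -- j places suffice to cover everything the solution covered at the end of a block.
  record Position (j : ℕ) : Set where
    field
      {t}    : ℕ
      us     : History (size labels) t
      tags   : All (λ u → tag u ℕ.< j ℕ.* suc κ) us
      unique : Unique us
      small  : Small us (kept-solution us)
      X      : Subset t
      ∣X∣≤j  : ∣ X ∣ ℕ.≤ j
      held   : ∀ i → reach us (kept-solution us) i ⊆ reach us X i
      fresh  : ∀ i → j ℕ.≤ i → reach us X i ≡ ⊥
      grown  : ι j ℚ.* growth (ι κ) (ι κ ℚ.+ ι n) ℚ.≤ dot Φ j (λ i → ι ∣ reach us X i ∣)

  start : Position 0
  start = record
    { us = [] ; tags = [] ; unique = [] ; small = λ () ; X = [] ; ∣X∣≤j = ℕ.z≤n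
    ; held = λ i → ⊆-refl ; fresh = λ _ _ → refl
    ; grown = ℚ.≤-reflexive (ℚ.*-zeroˡ (growth (ι κ) (ι κ ℚ.+ ι n))) }

  module Block {j : ℕ} (j<n : j ℕ.< n) (P : Position j) where
    old : ℕ → Subset κ
    old = reach (Position.us P) (Position.X P)

    -- The game inside block j after c copies.  Y consists of the summaries together
    -- with the c copies: the benchmark for the competitive ratio.
    record Progress (c : ℕ) : Set where
      field
        {t}    : ℕ
        us     : History (size labels) t
        tags   : All (λ u → tag u ℕ.< j ℕ.* suc κ ℕ.+ c) us
        unique : Unique us
        small  : Small us (kept-solution us)
        X      : Subset t
        ∣X∣≤j  : ∣ X ∣ ℕ.≤ j
        X≡old  : ∀ i → reach us X i ≡ old i
        Y      : Subset t
        ∣Y∣≤   : ∣ Y ∣ ℕ.≤ c ℕ.+ j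
        old⊆Y  : ∀ i → old i ⊆ reach us Y i
        copies : ∀ x → toℕ x ℕ.< c → x ∈ reach us Y j
        held   : ∀ i → i ≢ j → reach us (kept-solution us) i ⊆ old i

    begin-block : Progress 0
    begin-block = record
      { us = us ; tags = subst (λ s → All (λ u → tag u ℕ.< s) us) (sym (ℕ.+-identityʳ _)) tags
      ; unique = unique ; small = small ; X = X ; ∣X∣≤j = ∣X∣≤j ; X≡old = λ _ → refl
      ; Y = X ; ∣Y∣≤ = ∣X∣≤j ; old⊆Y = λ _ → ⊆-refl ; copies = λ _ () ; held = λ i _ → held i }
      where open Position P

    offer-copy : ∀ {c} → c ℕ.< κ → Progress c → Progress (suc c)
    offer-copy {c} c<κ M = record
      { us = u ∷ us
      ; tags = subst (tag u ℕ.<_) (sym (ℕ.+-suc _ c)) (ℕ.s≤s (ℕ.≤-reflexive tag-u))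
          ∷ All.map (λ v< → ℕ.<-≤-trans v< (ℕ.+-monoʳ-≤ (j ℕ.* suc κ) (ℕ.n≤1+n c))) tags
      ; unique = unique-∷ u us tag-u tags unique
      ; small = small-round u u-small small (includes u us) (keeps u us)
      ; X = outside ∷ X ; ∣X∣≤j = ∣X∣≤j ; X≡old = X≡old
      ; Y = inside ∷ Y ; ∣Y∣≤ = ℕ.s≤s ∣Y∣≤
      ; old⊆Y = λ i → ⊆-trans (old⊆Y i) (q⊆p∪q (rows u i) (reach us Y i))
      ; copies = copies′
      ; held = λ i i≢j → ⊆-trans (reach-round u us (includes u us) (keeps u us) (kept-solution us) i)
          (∪-lub (subst (_⊆ old i) (sym (≡⊥ (u⊆point i) (point-off j x i≢j))) ⊥⊆) (held i i≢j)) }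
      where
      open Progress M
      s<T = round<T j<n (ℕ.<⇒≤ c<κ)
      x = fromℕ< c<κ
      u = element s<T (point j x)
      tag-u = tag-element s<T (point j x)

      u⊆point : ∀ i → rows u i ⊆ point j x i
      u⊆point i = subst (_⊆ point j x i) (sym (rows-element s<T (point j x) i)) (row-truncate-⊆ n (point j x) i)

      u-at-j : rows u j ≡ ⁅ x ⁆
      u-at-j = trans (rows-element s<T (point j x) j) (trans (row-truncate (point j x) j<n) (point-at j x))

      u-small : ∑ n (λ i → ι ∣ rows u i ∣) ℚ.≤ 1ℚ
      u-small = ∑-single n j
        (λ i i≢j → cong ι (trans (cong ∣_∣ (≡⊥ (u⊆point i) (point-off j x i≢j))) (∣⊥∣≡0 κ)))
        (ℚ.≤-reflexive (cong ι (trans (cong ∣_∣ u-at-j) (∣⁅x⁆∣≡1 x))))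

      copies′ : ∀ z → toℕ z ℕ.< suc c → z ∈ rows u j ∪ reach us Y j
      copies′ z z<1+c with ℕ.m≤n⇒m<n∨m≡n (ℕ.s≤s⁻¹ z<1+c)
      ... | inj₁ z<c = q⊆p∪q (rows u j) (reach us Y j) (copies z z<c)
      ... | inj₂ z≡c = p⊆p∪q (reach us Y j) (subst₂ _∈_
              (toℕ-injective (trans (toℕ-fromℕ< c<κ) (sym z≡c))) (sym u-at-j) (x∈⁅x⁆ x))

    all-copies : ∀ c → c ℕ.≤ κ → Progress c
    all-copies zero    _   = begin-block
    all-copies (suc c) c<κ = offer-copy c<κ (all-copies c (ℕ.<⇒≤ c<κ))

    -- The summary u covers what the solution covers at the end of the block.
    next : Position (suc j)
    next = record
      { us = u ∷ us
      ; tags = subst (tag u ℕ.<_) end (ℕ.s≤s (ℕ.≤-reflexive tag-u))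
          ∷ All.map (λ {v} v< → subst (tag v ℕ.<_) end (ℕ.m≤n⇒m≤1+n v<)) tags
      ; unique = unique′
      ; small = subst (Small (u ∷ us)) (sym (proj₂ reject))
          λ { (suc p) (there p∈) → small p (p∩q⊆q (proj₁ reject) S p∈) }
      ; X = inside ∷ X
      ; ∣X∣≤j = ℕ.s≤s ∣X∣≤j
      ; held = λ i → subst (λ Z → reach (u ∷ us) Z i ⊆ new i) (sym (proj₂ reject))
          (⊆-trans (⋃-mono (λ p → rows (lookup us p) i) (p∩q⊆q (proj₁ reject) S)) (S⊆new i))
      ; fresh = λ i j<i → ≡⊥ (new⊆old i (ℕ.>⇒≢ j<i)) (Position.fresh P i (ℕ.<⇒≤ j<i))
      ; grown = grown′
      }
      where
      open Progress (all-copies κ ℕ.≤-refl)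
      S = kept-solution us
      B = reach us S
      s<T = round<T j<n (ℕ.≤-refl {κ})
      u = element s<T B
      tag-u = tag-element s<T B

      end : suc (j ℕ.* suc κ ℕ.+ κ) ≡ suc j ℕ.* suc κ
      end = cong suc (ℕ.+-comm (j ℕ.* suc κ) κ)

      unique′ = unique-∷ u us tag-u tags unique

      u⊆B : ∀ i → rows u i ⊆ B i
      u⊆B i = subst (_⊆ B i) (sym (rows-element s<T B i)) (row-truncate-⊆ n B i)

      u-at-j : rows u j ≡ B j
      u-at-j = trans (rows-element s<T B j) (row-truncate B j<n)

      reject = rejected u us unique′ u⊆B

      new : ℕ → Subset κ
      new = reach (u ∷ us) (inside ∷ X)

      new⊆old : ∀ i → i ≢ j → new i ⊆ old i
      new⊆old i i≢j = ∪-lub (⊆-trans (u⊆B i) (held i i≢j)) (subst (reach us X i ⊆_) (X≡old i) ⊆-refl)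

      old⊆new : ∀ i → old i ⊆ new i
      old⊆new i = subst (_⊆ new i) (X≡old i) (q⊆p∪q (rows u i) (reach us X i))

      S⊆new : ∀ i → B i ⊆ new i
      S⊆new i = cases (i ℕ.≟ j)
        where
        cases : Dec (i ≡ j) → B i ⊆ new i
        cases (yes refl) = subst (_⊆ new i) u-at-j (p⊆p∪q (reach us X i))
        cases (no i≢j)   = ⊆-trans (held i i≢j) (old⊆new i)

      new≡old : ∀ i → i ≢ j → new i ≡ old i
      new≡old i i≢j = ⊆-antisym (new⊆old i i≢j) (old⊆new i)

      y : ℕ → ℚ
      y i = ι ∣ B i ∣

      y-vanishes : ∀ i → suc j ℕ.≤ i → y i ≡ 0ℚ
      y-vanishes i j<i = cong ι (trans
        (cong ∣_∣ (≡⊥ (held i (ℕ.>⇒≢ j<i)) (Position.fresh P i (ℕ.<⇒≤ j<i)))) (∣⊥∣≡0 κ))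

      points-chosen : ∑ n y ℚ.≤ ι ∣ S ∣
      points-chosen = ⋃-size n (λ p → rows (lookup us p)) S (λ {p} → small p)

      capacity : ι ∣ S ∣ ℚ.≤ ι κ ℚ.+ ι n
      capacity = subst (ι ∣ S ∣ ℚ.≤_) (ι-+ κ n) (/1-mono {∣ S ∣} {κ ℕ.+ n} (feasible A coverage us unique))

      size-bound : ∑ (suc j) y ℚ.≤ ι κ ℚ.+ ι n
      size-bound = ℚ.≤-trans (∑-prefix {suc j} n {y} (λ i → 0≤ι ∣ B i ∣) j<n)
        (ℚ.≤-trans points-chosen capacity)

      0≤Λ^ : ∀ i → 0ℚ ℚ.≤ Λ ^ i
      0≤Λ^ i = ℚ.<⇒≤ (0<^ (0<+ 0<1 0<h) i)

      all-of-block : κ ℕ.≤ ∣ reach us Y j ∣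
      all-of-block = subst (ℕ._≤ ∣ reach us Y j ∣) (∣⊤∣≡n κ)
        (p⊆q⇒∣p∣≤∣q∣ {p = ⊤} λ {x} _ → copies x (toℕ<n x))

      block-ratio : ∑ j (λ i → Λ ^ i ℚ.* ι ∣ new i ∣) ℚ.+ Λ ^ j ℚ.* ι κ ℚ.≤
                    β ℚ.* ∑ (suc j) (λ i → Λ ^ i ℚ.* y i)
      block-ratio = begin
        ∑ j (λ i → Λ ^ i ℚ.* ι ∣ new i ∣) ℚ.+ Λ ^ j ℚ.* ι κ
          ≤⟨ ℚ.+-mono-≤ {∑ j (λ i → Λ ^ i ℚ.* ι ∣ new i ∣)} {∑ j z} {Λ ^ j ℚ.* ι κ} {z j}
              (∑-mono j λ i i<j → *-monoʳ (0≤Λ^ i) (/1-mono (p⊆q⇒∣p∣≤∣q∣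
                (⊆-trans (new⊆old i (ℕ.<⇒≢ i<j)) (old⊆Y i)))))
              (*-monoʳ (0≤Λ^ j) (/1-mono all-of-block)) ⟩
        ∑ j z ℚ.+ z j
          ≡⟨ ℚ.+-comm (∑ j z) (z j) ⟩
        ∑ (suc j) z
          ≤⟨ ∑-prefix n (λ i → 0≤* (0≤Λ^ i) (0≤ι ∣ reach us Y i ∣)) j<n ⟩
        weight (reach us Y)
          ≤⟨ competitive us unique Y (ℕ.≤-trans ∣Y∣≤ (ℕ.+-monoʳ-≤ κ (ℕ.<⇒≤ j<n))) ⟩
        β ℚ.* weight B
          ≡⟨ cong (β ℚ.*_) (∑-truncate n j<n λ i j<i →
               trans (cong (Λ ^ i ℚ.*_) (y-vanishes i j<i)) (ℚ.*-zeroʳ (Λ ^ i))) ⟩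
        β ℚ.* ∑ (suc j) (λ i → Λ ^ i ℚ.* y i) ∎
        where
        open ℚ.≤-Reasoning
        z : ℕ → ℚ
        z i = Λ ^ i ℚ.* ι ∣ reach us Y i ∣

      γ : ℚ
      γ = growth (ι κ) (ι κ ℚ.+ ι n)

      grown′ : ι (suc j) ℚ.* γ ℚ.≤ dot Φ (suc j) (λ i → ι ∣ new i ∣)
      grown′ = begin
        ι (suc j) ℚ.* γ
          ≡⟨ trans (cong (ℚ._* γ) (+-/1 j))
               (trans (ℚ.*-distribʳ-+ γ (ι j) 1ℚ) (cong (ι j ℚ.* γ ℚ.+_) (ℚ.*-identityˡ γ))) ⟩
        ι j ℚ.* γ ℚ.+ γ
          ≤⟨ ℚ.+-monoˡ-≤ γ (Position.grown P) ⟩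
        dot Φ j (λ i → ι ∣ old i ∣) ℚ.+ γ
          ≡⟨ cong (ℚ._+ γ) (dot-cong Φ j λ i i<j → cong (λ Z → ι ∣ Z ∣) (new≡old i (ℕ.<⇒≢ i<j))) ⟨
        dot Φ j (λ i → ι ∣ new i ∣) ℚ.+ γ
          ≤⟨ potential-step j {ι κ} {ι κ ℚ.+ ι n} {λ i → ι ∣ new i ∣} {y}
               (λ i → 0≤ι ∣ B i ∣) (λ i → /1-mono (p⊆q⇒∣p∣≤∣q∣ (S⊆new i)))
               size-bound block-ratio ⟩
        dot Φ (suc j) (λ i → ι ∣ new i ∣) ∎
        where open ℚ.≤-Reasoning

  play : ∀ j → j ℕ.≤ n → Position j
  play zero    _   = start
  play (suc j) j<n = Block.next j<n (play j (ℕ.<⇒≤ j<n))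

  covered-counts : ∃ λ (m : ℕ → ℚ) → (∀ i → 0ℚ ℚ.≤ m i) × (∀ i → m i ℚ.≤ ι κ) ×
    ι n ℚ.* growth (ι κ) (ι κ ℚ.+ ι n) ℚ.≤ dot Φ n m
  covered-counts = (λ i → ι ∣ reach us X i ∣) , (λ i → 0≤ι ∣ reach us X i ∣) ,
    (λ i → /1-mono (∣p∣≤n (reach us X i))) , grown
    where open Position (play n ℕ.≤-refl)

uncompetitive : ∀ α (1≤α : 1ℝ ≤ α) {β} → seq α eventually≤ β → Rate β → ∃ λ k → 1 ℕ.≤ k ×
  ¬ (∃ λ (A : OnlineAlgorithm k) →
     StrictlyMonotone A × HasCompetitiveRatio A (α ⁻¹⟨ 1≤⇒0< {α} 1≤α ⟩))
uncompetitive α 1≤α {β} α≤β r = refute potential-overflow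
  where
  open Potential r

  refute : (∃ λ n → ∃ λ κ → 1 ℕ.≤ κ × ∀ m → (∀ i → 0ℚ ℚ.≤ m i) → (∀ i → m i ℚ.≤ ι κ) →
      ¬ (ι n ℚ.* growth (ι κ) (ι κ ℚ.+ ι n) ℚ.≤ dot Φ n m)) →
    ∃ λ k → 1 ℕ.≤ k × ¬ (∃ λ (A : OnlineAlgorithm k) →
      StrictlyMonotone A × HasCompetitiveRatio A (α ⁻¹⟨ 1≤⇒0< {α} 1≤α ⟩))
  refute (n , κ , 1≤κ , overflow) = κ ℕ.+ n , ℕ.≤-trans 1≤κ (ℕ.m≤m+n κ n) ,
    λ (A , strict , ratio) →
      let m , 0≤m , m≤κ , grown = Game.covered-counts r α 1≤α α≤β n κ A strict ratio
      in overflow m 0≤m m≤κ grown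

theorem5p1 : ∀ (α : ℝ) (1≤α : 1ℝ ≤ α) → exp (α - 2ℝ) < α →
    ∃ λ (k : ℕ) → 1 ℕ.≤ k ×
    ¬ (∃ λ (A : OnlineAlgorithm k) →
    StrictlyMonotone A × HasCompetitiveRatio A (α ⁻¹⟨ 1≤⇒0< {α} 1≤α ⟩))
theorem5p1 α 1≤α gap =
  let β , y , 0<y , β<y+2 , α≤β , expSum≤β = rational-gap α gap
  in uncompetitive α 1≤α α≤β (rate β y 0<y β<y+2 expSum≤β)
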